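{- Let $n$ and $k$ be integers greater than or equal to $2$. The couple $(n, k)$ is equalizing if and only if either $k \equiv 1, 2 \pmod 4$ and $n \geq k + 1$, or $k \equiv 0, 3 \pmod 4$ and $n \geq k + 2$.
   Context: $B$ is a set with at least two elements. $[n] := \{1,\dots,n\}$ and $\Sigma_n$ is the symmetric group on $[n]$. For $\mathbf{a} \in A^n$ and $\sigma \in \Sigma_n$, write $\mathbf{a}\sigma := (a_{\sigma(1)},\dots,a_{\sigma(n)})$. Functions $f, g \colon A^n \to B$ are equivalent, $f \equiv g$, if there is $\sigma \in \Sigma_n$ with $f(\mathbf{a}) = g(\mathbf{a}\sigma)$ for all $\mathbf{a} \in A^n$. Let $A^r_{\neq}$ be the set of $r$-tuples over $A$ with pairwise distinct entries and $A^\sharp := \bigcup_{r \geq 1} A^r_{\neq}$. The map $\operatorname{ofo} \colon \bigcup_{n \geq 1} A^n \to A^\sharp$ sends a tuple $\mathbf{a}$ to the tuple listing the distinct elements occurring in $\mathbf{a}$ in the order of their first occurrence (i.e., all repetitions are removed, only the first occurrence of each element is kept). A function $f \colon A^n \to B$ is determined by the order of first occurrence if there exists $f^* \colon A^\sharp \to B$ such that $f = f^* \circ \operatorname{ofo}|_{A^n}$. The couple $(n, k)$ is equalizing (equivalence-equalizing for functions determined by the order of first occurrence) if for all $f, g \colon A^n \to B$ with $|A| = k$: if $f$ and $g$ are determined by the order of first occurrence and $f \equiv g$, then $f = g$. -}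

module Defs where

open import Data.Fin using (Fin)
open import Data.Fin.Permutation using (Permutation′; _⟨$⟩ʳ_)
open import Data.Fin.Properties using (inj⇒≟)
open import Data.List using (List; length; deduplicate)
open import Data.List.Relation.Unary.Unique.DecPropositional.Properties
  using (deduplicate-!)
open import Data.List.Relation.Unary.Unique.Propositional using (Unique)
open import Data.Nat using (ℕ; _≤_; z≤n; s≤s; NonZero)
open import Data.Product using (∃)
open import Data.Vec using (Vec; _∷_; lookup; tabulate; toList)
open import Function.Bundles using (_↔_)
open import Function.Properties.Inverse using (↔⇒↣)
open import Level using (Level; _⊔_) renaming (suc to lsuc; zero to 0ℓ)
open import Relation.Binary.Definitions using (DecidableEquality)
open import Relation.Binary.PropositionalEquality using (_≡_)

private
  variable
    a b : Level
    A : Set a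
    B : Set b
    n : ℕ

infixl 7 _·_

_·_ : Vec A n → Permutation′ n → Vec A n
u · σ = tabulate λ i → lookup u (σ ⟨$⟩ʳ i)

Equivalent : (f g : Vec A n → B) → Set _
Equivalent {n = n} f g = ∃ λ (σ : Permutation′ n) → ∀ u → f u ≡ g (u · σ)

-- The r-tuples with pairwise distinct entries, for all r ≥ 1 together: a list
-- is a tuple together with its length r.  The two conditions are irrelevant, so
-- a function on A ♯ depends on the entries only.
record _♯ (A : Set a) : Set a where
  constructor tuple
  field
    entries   : List A
    .nonEmpty : 1 ≤ length entries
    .distinct : Unique entries

open _♯ public

module _ (_≟_ : DecidableEquality A) where

  deduplicate-nonEmpty : .{{_ : NonZero n}} (u : Vec A n) →
                         1 ≤ length (deduplicate _≟_ (toList u))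
  deduplicate-nonEmpty (x ∷ u) = s≤s z≤n

  -- deduplicate keeps the first occurrence of each element.
  ofo : .{{_ : NonZero n}} → Vec A n → A ♯
  ofo u = tuple (deduplicate _≟_ (toList u))
                (deduplicate-nonEmpty u)
                (deduplicate-! _≟_ (toList u))

  DeterminedByOfo : .{{_ : NonZero n}} → (Vec A n → B) → Set _
  DeterminedByOfo {B = B} f = ∃ λ (f* : A ♯ → B) → ∀ u → f u ≡ f* (ofo u)

-- The bijection says |A| = k; it also supplies the decidable equality on A
-- that computing ofo requires.  Equality of f and g is pointwise.
Equalizing : Set b → (n k : ℕ) → .{{_ : NonZero n}} → Set (lsuc 0ℓ ⊔ b)
Equalizing B n k =
  (A : Set) (|A|=k : A ↔ Fin k) →
  let _≟_ = inj⇒≟ (↔⇒↣ |A|=k) in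
  (f g : Vec A n → B) →
  DeterminedByOfo _≟_ f → DeterminedByOfo _≟_ g →
  Equivalent f g → ∀ u → f u ≡ g u

{-# OPTIONS --safe #-}

-- Say f u = F (ofo u), g u = G (ofo u) and f u = g (u · σ).  List the positions in their natural
-- order (ps) and in the order given by σ (qs): a word u on the positions identifies F at the
-- reading of u along ps with G at its reading along qs.  Fix the number r of letters.
--
-- With n = r + 1 positions, one position repeats a letter that has occurred before and acts as
-- the hole of a fifteen puzzle: moving the hole along ps does not change the first reading,
-- moving it along qs does not change the second, and a pair of positions in opposite order in ps
-- and qs lets the hole jump between them.  A jump over γ rotates a block of the reading along ps
-- by one place.  These rotations generate all adjacent swaps needed to rearrange the reading along
-- qs into the one along ps, unless (after a possible common first position) σ exchanges
-- neighbouring positions in pairs.  Then only 3-cycles are available, and these suffice exactly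
-- when the number of pairs without the hole is even.  With n ≥ r + 2, discarding positions leads
-- back to n = r + 1, where the exception can be avoided.
--
-- Conversely, for n = k + 1 and an even number of pairs, exchanging the pairs reverses the parity
-- of every word with k letters; for n ≤ k a transposition of two positions reverses the parity of
-- every word without repetitions.

module Submission where

import Algebra.Solver.Monoid as MonoidSolver
open import Data.Bool using (Bool; true; false; if_then_else_; not; _xor_)
open import Data.Bool.Properties using (not-involutive)
open import Data.Bool.Solver using (module xor-∧-Solver)
open import Data.Empty using (⊥-elim)
open import Data.Fin as Fin using (Fin; zero; suc; inject≤)
import Data.Fin.Permutation as Permutation
open import Data.Fin.Permutation using (Permutation′; _⟨$⟩ʳ_; _⟨$⟩ˡ_; inverseˡ; inverseʳ)
open import Data.Fin.Properties using (<-cmp; inj⇒≟; inject≤-injective)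
open import Data.List using
  (List; []; _∷_; [_]; _++_; _∷ʳ_; length; map; take; filter; deduplicate; tabulate; allFin; initLast; _∷ʳ′_)
import Data.List.Membership.DecPropositional as DecMembership
open import Data.List.Membership.Propositional using (_∈_; _∉_)
open import Data.List.Membership.Propositional.Properties
  using (∈-++⁺ˡ; ∈-++⁺ʳ; ∈-++⁻; ∈-∃++; ∈-map⁺; ∈-map⁻; ∈-filter⁻; ∈-allFin)
open import Data.List.Membership.Propositional.Properties.WithK using (unique∧set⇒bag)
open import Data.List.Properties
  using (length-++; ++-assoc; ++-identityʳ; ++-monoid; take-map; length-++-≤ˡ; length-map; map-++;
         map-tabulate; map-cong; map-∘; length-tabulate; ∷-injective; filter-++; filter-all;
         filter-none; filter-accept; filter-reject; filter-idem)
open import Data.List.Relation.Binary.BagAndSetEquality using (∼bag⇒↭)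
open import Data.List.Relation.Binary.Permutation.Propositional
  using (_↭_; swap; ↭-refl; ↭-sym; ↭-trans; ↭-reflexive; ↭⇒↭ₛ)
open import Data.List.Relation.Binary.Permutation.Propositional.Properties
  using (↭-length; ++⁺ˡ; ++⁺ʳ; map⁺; ∈-resp-↭; shift; drop-∷; ∷↭∷ʳ; zoom; drop-mid; ↭-empty-inv;
         ¬x∷xs↭[]; filter-↭)
import Data.List.Relation.Binary.Permutation.Setoid.Properties as ↭S
open import Data.List.Relation.Unary.All as All using (All; []; _∷_)
open import Data.List.Relation.Unary.AllPairs using ([]; _∷_; tail)
open import Data.List.Relation.Unary.Any using (here; there)
open import Data.List.Relation.Unary.Unique.DecPropositional.Properties using (deduplicate-!)
open import Data.List.Relation.Unary.Unique.Propositional using (Unique)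
import Data.List.Relation.Unary.Unique.Propositional.Properties as UniqueProperties
open import Data.List.Relation.Unary.Unique.Propositional.Properties
  using (allFin⁺; Unique[x∷xs]⇒x∉xs)
open import Data.Nat as ℕ
  using (ℕ; zero; suc; _+_; _*_; _∸_; _≤_; _<_; _≥_; z≤n; s≤s; s≤s⁻¹; NonZero)
open import Data.Nat.DivMod using (_%_; _/_; [m+kn]%n≡m%n; m*n%n≡0; m%n<n; m≡m%n+[m/n]*n)
open import Data.Nat.Properties
  using (suc-injective; 1+n≢0; +-suc; +-comm; +-assoc; +-identityʳ; +-cancelˡ-≡; +-cancelˡ-≤; +-monoʳ-≤;
         *-assoc; *-monoˡ-≤; m≤m+n; m≤n+m; n≤1+n; m≤n⇒m≤1+n; m+[n∸m]≡n; m≤n⇒m<n∨m≡n; m≤n⇒∃[o]m+o≡n;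
         ≤-refl; ≤-trans; ≤-reflexive; ≤-pred; ≤-total; ≰⇒>; <⇒≤; <-irrefl)
open import Data.Product using (∃; ∃₂; _×_; _,_; proj₁; proj₂)
open import Data.Sum using (_⊎_; inj₁; inj₂)
open import Data.Vec as Vec using (Vec; []; _∷_; toList)
open import Data.Vec.Properties
  using (lookup∘tabulate; tabulate∘lookup; toList∘fromList; length-toList)
open import Defs
open import Function using (_∘_; id)
open import Function.Bundles using (_⇔_; _↔_; mk⇔; module Inverse)
open import Function.Construct.Identity using (↔-id)
open import Function.Properties.Inverse using (↔⇒↣)
open import Level using (Level; _⊔_)
open import Relation.Binary.Definitions using (DecidableEquality; tri<; tri≈; tri>)
open import Relation.Binary.PropositionalEquality
  using (_≡_; _≢_; refl; sym; trans; cong; cong₂; subst; subst₂; setoid; module ≡-Reasoning)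
open import Relation.Nullary using (¬_; ¬?; Dec; does; yes; no)
open import Relation.Nullary.Decidable using (dec-true; dec-false)

-- Identifying two positions first gives both orders a common first position, so only the letters
-- behind the first one have to be rearranged. The obstacle is that some adjacent swaps may be
-- impossible. An inner gap that no chord covers is a cut: in both orders the same position stands
-- there, with the same set of positions in front of it. No letter has to cross such a gap. It
-- therefore suffices that every inner gap is swappable or a cut, and this property spreads in both
-- directions from a single swappable gap, the seed. While it spreads, a chord may yield only
-- 3-cycles, which are even; the swap at the neighbouring gap supplies the missing odd permutation.
-- Without a seed no odd permutation is found: exchanged pairs yield 3-cycles that start at every
-- second place, and these perform two exchanges at a time. The residues modulo 4 come from there,
-- since two pairs occupy four positions.

private
  variable
    ℓ ℓ′ : Level
    C : Set ℓ

-- Splitting lists and their initial segments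

Unique-resp-↭ : {v w : List C} → v ↭ w → Unique v → Unique w
Unique-resp-↭ {C = C} = ↭S.Unique-resp-↭ (setoid C) ∘ ↭⇒↭ₛ

snoc-view : ∀ (x : C) X → ∃₂ λ Y y → x ∷ X ≡ Y ∷ʳ y
snoc-view x []      = [] , x , refl
snoc-view x (z ∷ X) with snoc-view z X
... | Y , y , eq = x ∷ Y , y , cong (x ∷_) eq

split-at : ∀ m (Y : List C) → m ≤ length Y → ∃₂ λ U V → Y ≡ U ++ V × length U ≡ m
split-at zero    Y       _         = [] , Y , refl , refl
split-at (suc m) (y ∷ Y) (s≤s m≤) with split-at m Y m≤
... | U , V , refl , refl = y ∷ U , V , refl , refl

split-+ : ∀ m {k} (Y : List C) → length Y ≡ m + k →
          ∃₂ λ U V → Y ≡ U ++ V × length U ≡ m × length V ≡ k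
split-+ m {k} Y eq with split-at m Y (subst (m ≤_) (sym eq) (m≤m+n m k))
... | U , V , refl , refl =
  U , V , refl , refl , +-cancelˡ-≡ (length U) _ _ (trans (sym (length-++ U)) eq)

∷ʳ-+ : ∀ (X : List C) x t → length (X ∷ʳ x) + t ≡ length X + suc t
∷ʳ-+ X x t = trans (cong (_+ t) (length-++ X)) (+-assoc (length X) 1 t)

∈-take : ∀ n {X : List C} {y} → y ∈ take n X → y ∈ X
∈-take (suc n) {x ∷ X} (here eq)  = here eq
∈-take (suc n) {x ∷ X} (there y∈) = there (∈-take n y∈)

∈-take-++ : ∀ (X : List C) {Y n y} → n ≤ length X → y ∈ take n (X ++ Y) → y ∈ X
∈-take-++ (x ∷ X) (s≤s n≤) (here eq)  = here eq
∈-take-++ (x ∷ X) (s≤s n≤) (there y∈) = there (∈-take-++ X n≤ y∈)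

∈-take-delete : ∀ (X : List C) {Y n x y} → length X ≤ n → y ≢ x →
                y ∈ take (suc n) (X ++ x ∷ Y) → y ∈ take n (X ++ Y)
∈-take-delete []      _        y≢x (here eq)  = ⊥-elim (y≢x eq)
∈-take-delete []      _        y≢x (there y∈) = y∈
∈-take-delete (_ ∷ X) (s≤s X≤) y≢x (here eq)  = here eq
∈-take-delete (_ ∷ X) (s≤s X≤) y≢x (there y∈) = there (∈-take-delete X X≤ y≢x y∈)

-- Two orders on the positions

module Order {P : Set} (_≟_ : DecidableEquality P) where

  private
    variable
      xs ys qs : List P
      i j k : P

  Before : List P → P → P → Set
  Before xs i j = ∃₂ λ X Y → xs ≡ X ++ j ∷ Y × i ∈ X

  -- The rank of j in xs is at most one more than the rank of i.
  Link : List P → P → P → Set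
  Link xs i j = ∃₂ λ X Y → xs ≡ X ++ i ∷ Y × (j ∈ X ⊎ ∃ λ Z → Y ≡ j ∷ Z)

  -- These are positions at which the hole may be placed, whatever the letters elsewhere.
  Good : List P → List P → P → Set
  Good ps qs i = (∃ λ h → Before ps h i × Before qs h i) ⊎
                 (∃₂ λ X j → ∃ λ Y → ps ≡ X ++ i ∷ j ∷ Y × Link qs i j)

  Before⇒Link : Before xs j i → Link xs i j
  Before⇒Link (X , Y , eq , j∈) = X , Y , eq , inj₁ j∈

  adjacent⇒Link : ∀ X {Y} → Link (X ++ i ∷ j ∷ Y) i j
  adjacent⇒Link X = X , _ , refl , inj₂ (_ , refl)

  ++⁺-eq : ∀ {x} {X Y Z : List P} → xs ≡ X ++ x ∷ Y → xs ++ Z ≡ X ++ x ∷ Y ++ Z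
  ++⁺-eq {X = X} refl = ++-assoc X _ _

  Before-++ : ∀ {Z} → Before xs i j → Before (xs ++ Z) i j
  Before-++ (X , Y , eq , i∈) = X , _ , ++⁺-eq eq , i∈

  Link-++ : ∀ {Z} → Link xs i j → Link (xs ++ Z) i j
  Link-++ (X , Y , eq , inj₁ j∈)         = X , _ , ++⁺-eq eq , inj₁ j∈
  Link-++ (X , Y , eq , inj₂ (_ , refl)) = X , _ , ++⁺-eq eq , inj₂ (_ , refl)

  Good-++ : ∀ {Z Z′} → Good xs ys i → Good (xs ++ Z) (ys ++ Z′) i
  Good-++ (inj₁ (h , p , q))           = inj₁ (h , Before-++ p , Before-++ q)
  Good-++ (inj₂ (X , j , Y , eq , l))  = inj₂ (X , j , _ , ++⁺-eq eq , Link-++ l)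

  ∈-split⁻ : ∀ X {Y} → k ∈ X ++ i ∷ Y → k ≢ i → k ∈ X ⊎ k ∈ Y
  ∈-split⁻ X k∈ k≢ with ∈-++⁻ X k∈
  ... | inj₁ k∈X         = inj₁ k∈X
  ... | inj₂ (here k≡i)  = ⊥-elim (k≢ k≡i)
  ... | inj₂ (there k∈Y) = inj₂ k∈Y

  Before-∈ʳ : ∀ X {Y} → k ∈ Y → Before (X ++ i ∷ Y) i k
  Before-∈ʳ X k∈ with ∈-∃++ k∈
  ... | U , V , refl = X ++ _ ∷ U , V , sym (++-assoc X _ _) , ∈-++⁺ʳ X (here refl)

  Before-++⁺ʳ : ∀ X → Before xs i j → Before (X ++ xs) i j
  Before-++⁺ʳ X (U , V , refl , i∈) = X ++ U , V , sym (++-assoc X U _) , ∈-++⁺ʳ X i∈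

  Link-between : Link qs i j → k ∈ qs → k ≢ i → k ≢ j →
                 Before qs k i ⊎ (Before qs i k × Link qs k j)
  Link-between (X , Y , refl , _) k∈ k≢i k≢j with ∈-split⁻ X k∈ k≢i
  Link-between (X , Y , refl , _) k∈ k≢i k≢j | inj₁ k∈X = inj₁ (X , Y , refl , k∈X)
  Link-between (X , Y , refl , inj₁ j∈X) k∈ k≢i k≢j | inj₂ k∈Y with ∈-∃++ k∈Y
  ... | U , V , refl =
    inj₂ (Before-∈ʳ X k∈Y , X ++ _ ∷ U , V , sym (++-assoc X _ _) , inj₁ (∈-++⁺ˡ j∈X))
  Link-between (X , Y , refl , inj₂ (Z , refl)) k∈ k≢i k≢j | inj₂ (here k≡j) = ⊥-elim (k≢j k≡j)
  Link-between (X , Y , refl , inj₂ (Z , refl)) k∈ k≢i k≢j | inj₂ (there k∈Z) with ∈-∃++ k∈Z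
  ... | U , V , refl = inj₂ (Before-∈ʳ X (there k∈Z) ,
    X ++ _ ∷ _ ∷ U , V , sym (++-assoc X _ _) , inj₁ (∈-++⁺ʳ X (there (here refl))))

  ≢-split : ∀ X {Y} → Unique (X ++ i ∷ Y) → k ∈ X ++ Y → k ≢ i
  ≢-split X X! k∈ refl = Unique[x∷xs]⇒x∉xs (Unique-resp-↭ (shift _ X _) X!) k∈

  -- Moving the hole from tgt to src rotates the letters on src and γ.
  record Chord (ps qs : List P) : Set where
    field
      {α γ β} : List P
      {src tgt} : P
      split   : ps ≡ α ++ src ∷ γ ++ tgt ∷ β
      good    : Good ps qs src
      link    : Link qs src tgt

  -- The gap `b` lies between the places `b` and `b + 1` of a word that has one letter fewer than
  -- there are positions. A chord rotating both places starts at rank at most `b` and ends at rank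
  -- at least `b + 2`, so it passes over the position `c` of rank `b + 1`.
  record Cut (ps qs : List P) (b : ℕ) : Set where
    constructor cut
    field
      {P₁ S₁ P₂ S₂} : List P
      {c}           : P
      ps≡           : ps ≡ P₁ ++ c ∷ S₁
      qs≡           : qs ≡ P₂ ++ c ∷ S₂
      P₁↭P₂         : P₁ ↭ P₂
      size          : length P₁ ≡ suc b

  -- A chord over a single position: moving the hole along it exchanges two neighbouring letters.
  Seed : List P → List P → Set
  Seed ps qs = ∃₂ λ X i → ∃₂ λ j k → ∃ λ Y → ps ≡ X ++ i ∷ j ∷ k ∷ Y × Good ps qs i × Link qs i k

  data Pairs : List P → List P → Set where
    []   : Pairs [] []
    pair : ∀ i j → Pairs xs ys → Pairs (i ∷ j ∷ xs) (j ∷ i ∷ ys)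

  data Rigid : List P → List P → Set where
    same      : Rigid xs xs
    pairs     : Pairs xs ys → Rigid xs ys
    one+pairs : ∀ i → Pairs xs ys → Rigid (i ∷ xs) (i ∷ ys)

  -- The number of pairs is even, so an odd number of complete pairs remains when the hole occupies
  -- a position of one of them.
  data Exceptional : List P → List P → Set where
    pairs     : ∀ q → Pairs xs ys → length xs ≡ q * 4 → Exceptional xs ys
    one+pairs : ∀ q i → Pairs xs ys → length xs ≡ q * 4 → Exceptional (i ∷ xs) (i ∷ ys)

  -- In both shapes one repetition produces a common first position `i`: `drop-repeat` discards `j`
  -- in the first, `merge-heads` identifies `i` and `j` in the second.
  data Heads : List P → List P → Set where
    same   : ∀ i j Y Z W → Heads (i ∷ j ∷ Y) (i ∷ Z ++ j ∷ W)
    differ : ∀ i j X Y Z W → i ≢ j → Heads (i ∷ X ++ j ∷ Y) (j ∷ Z ++ i ∷ W)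

  heads : ∀ {ps qs} → 2 ≤ length ps → ps ↭ qs → Heads ps qs
  heads {_ ∷ _} {[]}     _ p = ⊥-elim (¬x∷xs↭[] p)
  heads {i ∷ R} {j ∷ Q}  2≤ p with i ≟ j
  heads {i ∷ []}    {i ∷ Q} (s≤s ()) p | yes refl
  heads {i ∷ j ∷ Y} {i ∷ Q} 2≤ p | yes refl with ∈-∃++ (∈-resp-↭ (drop-∷ p) (here refl))
  ... | Z , W , refl = same i j Y Z W
  heads {i ∷ R} {j ∷ Q} 2≤ p | no i≢j with ∈-resp-↭ (↭-sym p) (here refl) | ∈-resp-↭ p (here refl)
  ... | here j≡i | _ = ⊥-elim (i≢j (sym j≡i))
  ... | _ | here i≡j = ⊥-elim (i≢j i≡j)
  ... | there j∈ | there i∈ with ∈-∃++ j∈ | ∈-∃++ i∈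
  ... | X , Y , refl | Z , W , refl = differ i j X Y Z W i≢j

  Before-∷⁻ : Before (k ∷ xs) i j → (k ≡ i × j ∈ xs) ⊎ Before xs i j
  Before-∷⁻ (x ∷ X , Y , refl , here refl) = inj₁ (refl , ∈-++⁺ʳ X (here refl))
  Before-∷⁻ (x ∷ X , Y , refl , there i∈)  = inj₂ (X , Y , refl , i∈)

  Before-∈₂ : Before xs i j → j ∈ xs
  Before-∈₂ (X , Y , refl , _) = ∈-++⁺ʳ X (here refl)

  Before-insert : ∀ X {Y} → Before (X ++ Y) i j → Before (X ++ k ∷ Y) i j
  Before-insert []      before = Before-++⁺ʳ [ _ ] before
  Before-insert (x ∷ X) before with Before-∷⁻ before
  ... | inj₂ before′ = Before-++⁺ʳ [ x ] (Before-insert X before′)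
  ... | inj₁ (refl , j∈) with ∈-++⁻ X j∈
  ...   | inj₁ j∈X = Before-∈ʳ [] (∈-++⁺ˡ j∈X)
  ...   | inj₂ j∈Y = Before-∈ʳ [] (∈-++⁺ʳ X (there j∈Y))

  Before-asym : Unique xs → Before xs i j → ¬ Before xs j i
  Before-asym {[]} _ ([] , _ , () , _)
  Before-asym {[]} _ (_ ∷ _ , _ , () , _)
  Before-asym {x ∷ xs} xs! p q with Before-∷⁻ p | Before-∷⁻ q
  ... | inj₁ (refl , j∈) | inj₁ (refl , _) = Unique[x∷xs]⇒x∉xs xs! j∈
  ... | inj₁ (refl , _)  | inj₂ q′         = Unique[x∷xs]⇒x∉xs xs! (Before-∈₂ q′)
  ... | inj₂ p′          | inj₁ (refl , _) = Unique[x∷xs]⇒x∉xs xs! (Before-∈₂ p′)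
  ... | inj₂ p′          | inj₂ q′         = Before-asym (tail xs!) p′ q′

  Pairs-length : Pairs xs ys → ∃ λ q → length xs ≡ q * 4 ⊎ length xs ≡ 2 + q * 4
  Pairs-length []           = 0 , inj₁ refl
  Pairs-length (pair i j p) with Pairs-length p
  ... | q , inj₁ eq = q , inj₂ (cong (2 +_) eq)
  ... | q , inj₂ eq = suc q , inj₁ (cong (2 +_) eq)

  Pairs-∷ʳ : ∀ i j → Pairs xs ys → Pairs (xs ++ i ∷ j ∷ []) (ys ++ j ∷ i ∷ [])
  Pairs-∷ʳ i j []           = pair i j []
  Pairs-∷ʳ i j (pair k l p) = pair k l (Pairs-∷ʳ i j p)

  Pairs-last : ∀ {i j} → Pairs (i ∷ xs) (j ∷ ys) →
               ∃₂ λ k l → ∃₂ λ X Y → i ∷ xs ≡ X ++ k ∷ l ∷ [] × j ∷ ys ≡ Y ++ l ∷ k ∷ []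
  Pairs-last (pair i j []) = i , j , [] , [] , refl , refl
  Pairs-last (pair i j (pair k l p)) with Pairs-last (pair k l p)
  ... | _ , _ , X , Y , e , e′ = _ , _ , i ∷ j ∷ X , j ∷ i ∷ Y , cong (λ Z → i ∷ j ∷ Z) e , cong (λ Z → j ∷ i ∷ Z) e′

  Seed-++ : ∀ {Z Z′} → Seed xs ys → Seed (xs ++ Z) (ys ++ Z′)
  Seed-++ (X , i , j , k , Y , eq , good , link) = X , i , j , k , _ , ++⁺-eq eq , Good-++ good , Link-++ link

  -- Seeds and rigid pairs of orders

  private
    -- If everything but i precedes or immediately follows i in qs, then i starts a seed as soon
    -- as two further elements follow it in ps.
    top-seed : ∀ X {i j k Y qs} → Unique (X ++ i ∷ j ∷ k ∷ Y) →
               (∀ {z} → z ∈ X ++ i ∷ j ∷ k ∷ Y → z ≢ i → Link qs i z) →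
               (∀ {z} → z ∈ X → Before qs z i) → Seed (X ++ i ∷ j ∷ k ∷ Y) qs
    top-seed X {i} {j} {k} {Y} {qs} ps! links befores =
      X , i , j , k , Y , refl , good X ps! links befores ,
      links (∈-++⁺ʳ X (there (there (here refl)))) (≢-split X ps! (∈-++⁺ʳ X (there (here refl))))
      where
      good : ∀ X → Unique (X ++ i ∷ j ∷ k ∷ Y) →
             (∀ {z} → z ∈ X ++ i ∷ j ∷ k ∷ Y → z ≢ i → Link qs i z) →
             (∀ {z} → z ∈ X → Before qs z i) → Good (X ++ i ∷ j ∷ k ∷ Y) qs i
      good []      ps! links befores = inj₂ ([] , j , k ∷ Y , refl , links (there (here refl)) (≢-split [] ps! (here refl)))
      good (h ∷ X) ps! links befores = inj₁ (h , (h ∷ X , j ∷ k ∷ Y , refl , here refl) , befores (here refl))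

    -- A common position cannot follow an exchanged pair without a seed: `k` is good because its
    -- successor `l` precedes it in the second order, where `m` directly follows it.
    pairs-seed : ∀ X Y k l m → Seed ((X ++ k ∷ l ∷ []) ++ [ m ]) ((Y ++ l ∷ k ∷ []) ++ [ m ])
    pairs-seed X Y k l m = X , k , l , m , [] , ++-assoc X _ _ ,
      inj₂ (X , l , [ m ] , ++-assoc X _ _ , Y ++ [ l ] , [ m ] , Y≡ , inj₁ (∈-++⁺ʳ Y (here refl))) ,
      Y ++ [ l ] , [ m ] , Y≡ , inj₂ ([] , refl)
      where
      Y≡ : (Y ++ l ∷ k ∷ []) ++ [ m ] ≡ (Y ++ [ l ]) ++ k ∷ m ∷ []
      Y≡ = trans (++-assoc Y _ _) (sym (++-assoc Y _ _))

    snoc-rigid : ∀ m → Rigid xs ys → Seed (xs ++ [ m ]) (ys ++ [ m ]) ⊎ Rigid (xs ++ [ m ]) (ys ++ [ m ])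
    snoc-rigid m same = inj₂ same
    snoc-rigid m (pairs []) = inj₂ same
    snoc-rigid m (pairs (pair i j p)) with Pairs-last (pair i j p)
    ... | k , l , X , Y , e , e′ =
      inj₁ (subst₂ (λ xs ys → Seed (xs ++ [ m ]) (ys ++ [ m ])) (sym e) (sym e′) (pairs-seed X Y k l m))
    snoc-rigid m (one+pairs h []) = inj₂ same
    snoc-rigid m (one+pairs h (pair i j p)) with Pairs-last (pair i j p)
    ... | k , l , X , Y , e , e′ =
      inj₁ (subst₂ (λ xs ys → Seed (h ∷ xs ++ [ m ]) (h ∷ ys ++ [ m ])) (sym e) (sym e′) (pairs-seed (h ∷ X) (h ∷ Y) k l m))

    snoc₂-rigid : ∀ m n → Rigid xs ys →
                  Seed (xs ++ m ∷ n ∷ []) (ys ++ n ∷ m ∷ []) ⊎ Rigid (xs ++ m ∷ n ∷ []) (ys ++ n ∷ m ∷ [])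
    snoc₂-rigid {xs} m n same with initLast xs
    ... | []            = inj₂ (pairs (pair m n []))
    ... | []      ∷ʳ′ l = inj₂ (one+pairs l (pair m n []))
    -- With two common positions in front of an exchanged pair, `h` makes `l` good, and the seed
    -- jumps from `l` over `m` to `n`, the successor of `l` in the second order.
    ... | (h ∷ X) ∷ʳ′ l = inj₁ (h ∷ X , l , m , n , [] , assoc (m ∷ n ∷ []) ,
      inj₁ (h , (h ∷ X , _ , assoc _ , here refl) , (h ∷ X , _ , assoc _ , here refl)) ,
      h ∷ X , _ , assoc (n ∷ m ∷ []) , inj₂ (_ , refl))
      where
      assoc : ∀ Z → ((h ∷ X) ∷ʳ l) ++ Z ≡ h ∷ X ++ l ∷ Z
      assoc Z = ++-assoc (h ∷ X) [ l ] Z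
    snoc₂-rigid m n (pairs p)       = inj₂ (pairs (Pairs-∷ʳ m n p))
    snoc₂-rigid m n (one+pairs i p) = inj₂ (one+pairs i (Pairs-∷ʳ m n p))

    ↭-delete-last : ∀ X {Y m} → X ++ m ∷ Y ↭ ys ++ [ m ] → X ++ Y ↭ ys
    ↭-delete-last {ys} X p = ↭-trans (drop-mid X ys p) (↭-reflexive (++-identityʳ ys))

  -- Working from the end of qs: its last element m is last or last but one in ps unless it
  -- starts a seed, and in the second case so does the element before m in qs unless it is last in ps.
  seed-or-rigid : ∀ n {ps qs} → length ps ≤ n → ps ↭ qs → Unique ps → Seed ps qs ⊎ Rigid ps qs
  seed-or-rigid n {ps} {qs} ≤n p ps! with initLast qs
  ... | [] rewrite ↭-empty-inv p = inj₂ same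
  ... | qs₁ ∷ʳ′ m with ∈-∃++ (∈-resp-↭ (↭-sym p) (∈-++⁺ʳ qs₁ (here refl)))
  ... | X , j ∷ k ∷ Y , refl = inj₁ (top-seed X ps! (λ z∈ z≢ → Before⇒Link (before z∈ z≢))
                                 (λ z∈ → before (∈-++⁺ˡ z∈) (≢-split X ps! (∈-++⁺ˡ z∈))))
    where
    before : ∀ {z} → z ∈ X ++ m ∷ j ∷ k ∷ Y → z ≢ m → Before (qs₁ ∷ʳ m) z m
    before z∈ z≢ with ∈-split⁻ qs₁ (∈-resp-↭ p z∈) z≢
    ... | inj₁ z∈qs₁ = qs₁ , [] , refl , z∈qs₁
  seed-or-rigid zero ≤n p ps! | qs₁ ∷ʳ′ m | [] , [] , refl with () ← ≤n
  seed-or-rigid zero ≤n p ps! | qs₁ ∷ʳ′ m | _ ∷ _ , [] , refl with () ← ≤n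
  seed-or-rigid (suc n) ≤n p ps! | qs₁ ∷ʳ′ m | X , [] , refl
    with seed-or-rigid n {X} {qs₁} (s≤s⁻¹ (subst (_≤ suc n) (trans (length-++ X) (+-comm _ 1)) ≤n))
           (subst (_↭ qs₁) (++-identityʳ X) (↭-delete-last X p))
           (subst Unique (++-identityʳ X) (tail (Unique-resp-↭ (shift m X []) ps!)))
  ... | inj₁ seed  = inj₁ (Seed-++ seed)
  ... | inj₂ rigid = snoc-rigid m rigid
  seed-or-rigid n ≤n p ps! | qs₁ ∷ʳ′ m | X , l ∷ [] , refl with initLast qs₁
  ... | [] with () ← trans (sym (↭-length p)) (trans (length-++ X) (+-comm (length X) 2))
  ... | qs₂ ∷ʳ′ q with q ≟ l
  seed-or-rigid zero ≤n p ps! | _ | [] , l ∷ [] , refl | qs₂ ∷ʳ′ q | yes refl with () ← ≤n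
  seed-or-rigid zero ≤n p ps! | _ | _ ∷ _ , l ∷ [] , refl | qs₂ ∷ʳ′ q | yes refl with () ← ≤n
  seed-or-rigid (suc n) ≤n p ps! | _ ∷ʳ′ m | X , l ∷ [] , refl | qs₂ ∷ʳ′ q | yes refl
    with seed-or-rigid n {X} {qs₂} (≤-trans (n≤1+n _) (s≤s⁻¹ (subst (_≤ suc n) (trans (length-++ X) (+-comm _ 2)) ≤n)))
           (subst (_↭ qs₂) (++-identityʳ X) (↭-delete-last X (↭-delete-last X p)))
           (subst Unique (++-identityʳ X) (tail (Unique-resp-↭ (shift q X [])
             (tail (Unique-resp-↭ (shift m X _) ps!)))))
  ... | inj₁ seed  = inj₁ (subst (Seed _) (sym (++-assoc qs₂ _ _)) (Seed-++ seed))
  ... | inj₂ rigid = subst (λ qs → Seed _ qs ⊎ Rigid _ qs) (sym (++-assoc qs₂ _ _)) (snoc₂-rigid m q rigid)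
  seed-or-rigid n ≤n p ps! | _ ∷ʳ′ m | X , l ∷ [] , refl | qs₂ ∷ʳ′ q | no q≢l
    with ∈-split⁻ X (∈-resp-↭ (↭-sym p) (∈-++⁺ˡ (∈-++⁺ʳ qs₂ (here refl))))
           (≢-split (qs₂ ∷ʳ q) (Unique-resp-↭ p ps!) (∈-++⁺ˡ (∈-++⁺ʳ qs₂ (here refl))))
  ... | inj₂ (here q≡l) = ⊥-elim (q≢l q≡l)
  ... | inj₁ q∈X with ∈-∃++ q∈X
  ... | X₁ , X₂ , refl = inj₁ (subst₂ Seed (sym (++-assoc X₁ _ _)) (sym qs≡)
      (go X₁ X₂ (subst Unique (++-assoc X₁ _ _) ps!) (subst₂ _↭_ (++-assoc X₁ _ _) qs≡ p)))
    where
    qs≡ : (qs₂ ∷ʳ q) ∷ʳ m ≡ qs₂ ++ q ∷ m ∷ []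
    qs≡ = ++-assoc qs₂ _ _
    module _ {Z} (p : Z ↭ qs₂ ++ q ∷ m ∷ []) where
      link : ∀ {z} → z ∈ Z → z ≢ q → Link (qs₂ ++ q ∷ m ∷ []) q z
      link z∈ z≢ with ∈-split⁻ qs₂ (∈-resp-↭ p z∈) z≢
      ... | inj₁ z∈         = qs₂ , _ , refl , inj₁ z∈
      ... | inj₂ (here refl) = qs₂ , _ , refl , inj₂ (_ , refl)
      before : ∀ {z} → z ∈ Z → z ≢ q → z ≢ m → Before (qs₂ ++ q ∷ m ∷ []) z q
      before z∈ z≢q z≢m with ∈-split⁻ qs₂ (∈-resp-↭ p z∈) z≢q
      ... | inj₁ z∈        = qs₂ , _ , refl , z∈
      ... | inj₂ (here eq) = ⊥-elim (z≢m eq)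
    go : ∀ X₁ X₂ → Unique (X₁ ++ q ∷ X₂ ++ m ∷ l ∷ []) →
         X₁ ++ q ∷ X₂ ++ m ∷ l ∷ [] ↭ qs₂ ++ q ∷ m ∷ [] →
         Seed (X₁ ++ q ∷ X₂ ++ m ∷ l ∷ []) (qs₂ ++ q ∷ m ∷ [])
    go X₁ X₂ ps! p = seed X₂ ps! p (λ z∈ → before p (∈-++⁺ˡ z∈) (≢-split X₁ ps! (∈-++⁺ˡ z∈))
        (≢-split (X₁ ++ q ∷ X₂) (subst Unique (sym (++-assoc X₁ _ _)) ps!) (∈-++⁺ˡ (∈-++⁺ˡ z∈))))
      where
      seed : ∀ X₂ → Unique (X₁ ++ q ∷ X₂ ++ m ∷ l ∷ []) →
         X₁ ++ q ∷ X₂ ++ m ∷ l ∷ [] ↭ qs₂ ++ q ∷ m ∷ [] →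
         (∀ {z} → z ∈ X₁ → Before (qs₂ ++ q ∷ m ∷ []) z q) →
         Seed (X₁ ++ q ∷ X₂ ++ m ∷ l ∷ []) (qs₂ ++ q ∷ m ∷ [])
      seed []           ps! p bf = top-seed X₁ ps! (link p) bf
      seed (_ ∷ [])     ps! p bf = top-seed X₁ ps! (link p) bf
      seed (_ ∷ _ ∷ X₂) ps! p bf = top-seed X₁ ps! (link p) bf

  -- Cuts and chords covering a gap

  private
    open DecMembership _≟_ using (_∈?_)

    sorted-or-inverted : ∀ (U T : List P) →
      (∃₂ λ X Y → T ≡ X ++ Y × All (_∈ U) X × All (_∉ U) Y) ⊎
      (∃₂ λ s p → Before T s p × s ∉ U × p ∈ U)
    sorted-or-inverted U []      = inj₁ ([] , [] , refl , [] , [])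
    sorted-or-inverted U (z ∷ T) with sorted-or-inverted U T
    ... | inj₂ (s , p , before , s∉ , p∈) = inj₂ (s , p , Before-++⁺ʳ [ z ] before , s∉ , p∈)
    ... | inj₁ (X , Y , refl , X⊆ , Y∩) with z ∈? U
    ...   | yes z∈ = inj₁ (z ∷ X , Y , refl , z∈ ∷ X⊆ , Y∩)
    sorted-or-inverted U (z ∷ T) | inj₁ ([] , Y , refl , _ , Y∩) | no z∉ =
      inj₁ ([] , z ∷ Y , refl , [] , z∉ ∷ Y∩)
    sorted-or-inverted U (z ∷ T) | inj₁ (p ∷ X , Y , refl , p∈ ∷ _ , _) | no z∉ =
      inj₂ (z , p , ([ z ] , _ , refl , here refl) , z∉ , p∈)

    ↭-restrict : ∀ (U : List P) {X Y Z} → All (_∉ U) Y → All (_∈ U) X → All (_∉ U) Z →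
                 U ++ Y ↭ X ++ Z → U ↭ X
    ↭-restrict U {X} {Y} {Z} Y∩ X⊆ Z∩ p =
      subst₂ _↭_ (restrict U (All.tabulate λ z∈ → z∈) Y∩) (restrict X X⊆ Z∩) (filter-↭ (_∈? U) p)
      where
      restrict : ∀ V {W} → All (_∈ U) V → All (_∉ U) W → filter (_∈? U) (V ++ W) ≡ V
      restrict V {W} V⊆ W∩ = trans (filter-++ (_∈? U) V W)
        (trans (cong₂ _++_ (filter-all (_∈? U) V⊆) (filter-none (_∈? U) W∩)) (++-identityʳ V))

  -- Let `U` be the part of `ps` before `c`. An element of `s ∷ S₁` that precedes one of `U` in `qs`
  -- gives a link. If there is none, `U` is an initial segment of `qs` without `c`. Unless this
  -- segment ends exactly at `c`, its last element is directly followed by an element of `s ∷ S₁`,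
  -- which is again a link.
  cut-or-link : ∀ {b p c s} P₁ S₁ → Unique ((p ∷ P₁) ++ c ∷ s ∷ S₁) → (p ∷ P₁) ++ c ∷ s ∷ S₁ ↭ qs →
                length P₁ ≡ b → Cut ((p ∷ P₁) ++ c ∷ s ∷ S₁) qs b ⊎
                (∃₂ λ i j → i ∈ p ∷ P₁ × j ∈ s ∷ S₁ × Link qs i j)
  cut-or-link {qs} {b} {p} {c} {s} P₁ S₁ ps! ps↭qs size
    with ∈-∃++ (∈-resp-↭ ps↭qs (∈-++⁺ʳ (p ∷ P₁) (here refl)))
  ... | Q , R , refl = analyse (sorted-or-inverted U Q) (sorted-or-inverted U R)
    where
    U = p ∷ P₁
    Goal : Set
    Goal = Cut (U ++ c ∷ s ∷ S₁) (Q ++ c ∷ R) b ⊎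
           (∃₂ λ i j → i ∈ U × j ∈ s ∷ S₁ × Link (Q ++ c ∷ R) i j)
    ps!′ : Unique (c ∷ U ++ s ∷ S₁)
    ps!′ = Unique-resp-↭ (shift c U _) ps!
    rest : U ++ s ∷ S₁ ↭ Q ++ R
    rest = drop-mid U Q ps↭qs
    beyond : ∀ {z} → z ∈ Q ++ R → z ∉ U → z ∈ s ∷ S₁
    beyond z∈ z∉ with ∈-++⁻ U (∈-resp-↭ (↭-sym rest) z∈)
    ... | inj₁ z∈U = ⊥-elim (z∉ z∈U)
    ... | inj₂ z∈S = z∈S
    inverted : ∀ {i j} → Before (Q ++ c ∷ R) j i → i ∈ U → j ∈ Q ++ R → j ∉ U → Goal
    inverted before i∈ j∈ j∉ = inj₂ (_ , _ , i∈ , beyond j∈ j∉ , Before⇒Link before)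
    Before-∈ : ∀ {T i j} → Before T i j → i ∈ T
    Before-∈ (X , Y , refl , i∈) = ∈-++⁺ˡ i∈
    S∩U : All (_∉ U) (s ∷ S₁)
    S∩U = All.tabulate λ z∈S z∈U → disjoint U (tail ps!′) z∈U z∈S
      where
      disjoint : ∀ X {Y z} → Unique (X ++ Y) → z ∈ X → z ∉ Y
      disjoint (x ∷ X) X!       (here refl) z∈Y = Unique[x∷xs]⇒x∉xs X! (∈-++⁺ʳ X z∈Y)
      disjoint (x ∷ X) (_ ∷ X!) (there z∈X) z∈Y = disjoint X X! z∈X z∈Y
    p-late : All (_∉ U) Q → p ∈ R
    p-late Q∩ with ∈-++⁻ Q (∈-resp-↭ rest (here refl))
    ... | inj₁ p∈Q = ⊥-elim (All.lookup Q∩ p∈Q (here refl))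
    ... | inj₂ p∈R = p∈R
    s-early : All (_∈ U) R → s ∈ Q
    s-early R⊆ with ∈-++⁻ Q (∈-resp-↭ rest (∈-++⁺ʳ U (here refl)))
    ... | inj₁ s∈Q = s∈Q
    ... | inj₂ s∈R = ⊥-elim (All.lookup S∩U (here refl) (All.lookup R⊆ s∈R))
    across : ∀ {i j} → j ∈ Q → i ∈ R → Before (Q ++ c ∷ R) j i
    across j∈ i∈ with ∈-∃++ i∈
    ... | X , Y , refl = Q ++ c ∷ X , Y , sym (++-assoc Q _ _) , ∈-++⁺ˡ j∈
    adjacent : ∀ {i j X Y} → Q ++ c ∷ R ≡ X ++ i ∷ j ∷ Y → i ∈ U → j ∈ Q ++ R → j ∉ U → Goal
    adjacent {X = X} eq i∈ j∈ j∉ = inj₂ (_ , _ , i∈ , beyond j∈ j∉ , X , _ , eq , inj₂ (_ , refl))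
    analyse : _ → _ → Goal
    analyse (inj₂ (j , i , before , j∉ , i∈)) _ =
      inverted (Before-++ before) i∈ (∈-++⁺ˡ (Before-∈ before)) j∉
    analyse (inj₁ _) (inj₂ (j , i , before , j∉ , i∈)) =
      inverted (Before-++⁺ʳ Q (Before-++⁺ʳ [ c ] before)) i∈ (∈-++⁺ʳ Q (Before-∈ before)) j∉
    analyse (inj₁ (Q₁ , [] , Q≡ , Q₁⊆ , _)) (inj₁ ([] , R₂ , refl , _ , R₂∩)) =
      inj₁ (cut refl refl (↭-restrict U S∩U (subst (All (_∈ U)) (sym (trans Q≡ (++-identityʳ Q₁))) Q₁⊆) R₂∩ rest) (cong suc size))
    analyse (inj₁ (Q₁ , j ∷ Q₂ , Q≡ , Q₁⊆ , j∉ ∷ Q₂∩)) _ with initLast Q₁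
    ... | [] = inverted (across j∈Q (p-late (subst (All (_∉ U)) (sym Q≡) (j∉ ∷ Q₂∩)))) (here refl) (∈-++⁺ˡ j∈Q) j∉
      where j∈Q = subst (j ∈_) (sym Q≡) (here refl)
    ... | Q₀ ∷ʳ′ i = adjacent {X = Q₀}
      (trans (cong (_++ c ∷ R) Q≡) (trans (++-assoc (Q₀ ∷ʳ i) _ _) (++-assoc Q₀ _ _)))
      (All.lookup Q₁⊆ (∈-++⁺ʳ Q₀ (here refl)))
      (∈-++⁺ˡ (subst (j ∈_) (sym Q≡) (∈-++⁺ʳ (Q₀ ∷ʳ i) (here refl)))) j∉
    analyse (inj₁ (Q₁ , [] , _ , Q₁⊆ , _)) (inj₁ (i ∷ R₁ , [] , R≡ , R₁⊆ , _)) =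
      inverted (across (s-early R⊆) (subst (i ∈_) (sym R≡) (here refl))) (All.lookup R₁⊆ (here refl))
        (∈-++⁺ˡ (s-early R⊆)) (All.lookup S∩U (here refl))
      where R⊆ = subst (All (_∈ U)) (sym (trans R≡ (++-identityʳ (i ∷ R₁)))) R₁⊆
    analyse (inj₁ (Q₁ , [] , _ , Q₁⊆ , _)) (inj₁ (i ∷ R₁ , j ∷ R₂ , R≡ , R₁⊆ , j∉ ∷ _)) with snoc-view i R₁
    ... | R₀ , l , iR₁≡ = adjacent {X = Q ++ c ∷ R₀}
      (trans (cong (λ R → Q ++ c ∷ R) (trans R≡ (trans (cong (_++ j ∷ R₂) iR₁≡) (++-assoc R₀ _ _)))) (sym (++-assoc Q _ _)))
      (All.lookup R₁⊆ (subst (l ∈_) (sym iR₁≡) (∈-++⁺ʳ R₀ (here refl))))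
      (∈-++⁺ʳ Q (subst (j ∈_) (sym R≡) (∈-++⁺ʳ (i ∷ R₁) (here refl)))) j∉

  -- If i is not good, then a neighbour of i is, and it is linked to j as well.
  good-source : ∀ {ps qs} U {b V i j} → ps ≡ U ++ V → Unique ps → ps ↭ qs → length U ≡ suc (suc b) →
                i ∈ U → j ∈ V → Link qs i j → ∃ λ k → k ∈ U × Good ps qs k × Link qs k j
  good-source {qs = qs} U {b} {V} {i} {j} refl ps! ps↭qs size i∈ j∈ link with ∈-∃++ i∈
  ... | X , Y , refl with initLast X
  good-source _ {V = V} {i} {j} refl ps! ps↭qs size i∈ j∈ link | _ , Y , refl | X ∷ʳ′ h
    with Link-between link (∈-resp-↭ ps↭qs h∈ps) h≢i h≢j
    where
    h∈ps : h ∈ ((X ∷ʳ h) ++ i ∷ Y) ++ V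
    h∈ps = ∈-++⁺ˡ (∈-++⁺ˡ (∈-++⁺ʳ X (here refl)))
    h≢i : h ≢ i
    h≢i = ≢-split (X ∷ʳ h) (subst Unique (++-assoc (X ∷ʳ h) _ _) ps!) (∈-++⁺ˡ (∈-++⁺ʳ X (here refl)))
    h≢j : h ≢ j
    h≢j refl = ≢-split X (subst Unique (trans (++-assoc (X ∷ʳ h) _ _) (++-assoc X _ _)) ps!) (∈-++⁺ʳ X (there (∈-++⁺ʳ Y j∈))) refl
  ... | inj₁ before = i , i∈ , inj₁ (h , (X ∷ʳ h , Y ++ V , ++-assoc (X ∷ʳ h) _ _ , ∈-++⁺ʳ X (here refl)) , before) , link
  ... | inj₂ (before , link′) = h , ∈-++⁺ˡ (∈-++⁺ʳ X (here refl)) ,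
    inj₂ (X , i , Y ++ V , trans (++-assoc (X ∷ʳ h) _ _) (++-assoc X _ _) , Before⇒Link before) , link′
  good-source _ {V = V} {i} {j} refl ps! ps↭qs size i∈ j∈ link | _ , k ∷ Y , refl | []
    with Link-between link (∈-resp-↭ ps↭qs (there (here refl))) k≢i k≢j
    where
    k≢i : k ≢ i
    k≢i = ≢-split [] ps! (here refl)
    k≢j : k ≢ j
    k≢j refl = Unique[x∷xs]⇒x∉xs (tail ps!) (∈-++⁺ʳ Y j∈)
  ... | inj₁ before = i , i∈ , inj₂ ([] , k , Y ++ V , refl , Before⇒Link before) , link
  ... | inj₂ (before , link′) =
    k , there (here refl) , inj₁ (i , ([ i ] , Y ++ V , refl , here refl) , before) , link′

  record Covering (ps qs : List P) (b : ℕ) : Set where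
    field
      chord : Chord ps qs
    open Chord chord public
    field
      left  : length α ≤ b
      right : suc b ≤ length α + length γ

  -- The link from `cut-or-link` may start at a position that is not good. The hypothesis `1 ≤ b`
  -- ensures two positions before `c`, so that `good-source` can pass to a neighbour.
  cut-or-covering : ∀ {ps qs} b → 1 ≤ b → suc (suc b) < length ps → Unique ps → ps ↭ qs →
                    Cut ps qs b ⊎ Covering ps qs b
  cut-or-covering {ps} (suc b) (s≤s z≤n) <n ps! ps↭qs with split-at (3 + b) ps (<⇒≤ <n)
  ... | W , [] , refl , lW = ⊥-elim (<-irrefl (sym (trans (cong length (++-identityʳ W)) lW)) <n)
  ... | W , s ∷ S , refl , lW with initLast W
  ... | U ∷ʳ′ c = go U lU
        (subst Unique (++-assoc U _ _) ps!) (subst (_↭ _) (++-assoc U _ _) ps↭qs) (++-assoc U _ _)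
    where
    lU : length U ≡ 2 + b
    lU = suc-injective (trans (+-comm 1 _) (trans (sym (length-++ U)) lW))
    go : ∀ {ps qs} U → length U ≡ 2 + b → Unique (U ++ c ∷ s ∷ S) → U ++ c ∷ s ∷ S ↭ qs →
         ps ≡ U ++ c ∷ s ∷ S → Cut ps qs (suc b) ⊎ Covering ps qs (suc b)
    go (p ∷ U) lU ps! ps↭qs refl with cut-or-link U S ps! ps↭qs (suc-injective lU)
    ... | inj₁ found = inj₁ found
    ... | inj₂ (i , j , i∈ , j∈ , link) with good-source (p ∷ U) refl ps! ps↭qs lU i∈ (there j∈) link
    ... | k , k∈ , good , link′ with ∈-∃++ k∈ | ∈-∃++ j∈
    ... | α , δ , U≡ | ε , β , S≡ = inj₂ record
      { chord = record { α = α ; γ = δ ++ c ∷ ε ; β = β ; good = good ; link = link′ ; split =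
          trans (cong₂ _++_ U≡ (cong (c ∷_) S≡))
                (solve 6 (λ α k δ c ε β → (α ⊕ k ⊕ δ) ⊕ c ⊕ ε ⊕ β ⊜ α ⊕ k ⊕ (δ ⊕ c ⊕ ε) ⊕ β)
                  refl α [ k ] δ [ c ] ε (j ∷ β)) }
      ; left = ≤-trans (m≤m+n _ (length δ)) (≤-reflexive αδ)
      ; right = ≤-trans (≤-reflexive (trans (cong suc (sym αδ)) (trans (cong suc (+-comm (length α) _)) (+-comm (suc (length δ)) _))))
          (+-monoʳ-≤ (length α) (≤-trans (≤-trans (≤-reflexive (+-comm 1 _)) (+-monoʳ-≤ (length δ) (s≤s z≤n))) (≤-reflexive (sym (length-++ δ)))))
      }
      where
      open MonoidSolver (++-monoid P) using (solve; _⊕_; _⊜_)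
      αδ : length α + length δ ≡ suc b
      αδ = suc-injective (trans (sym (+-suc (length α) _)) (trans (sym (length-++ α)) (trans (cong length (sym U≡)) lU)))

-- Local moves on words

module Exchange {A : Set ℓ} {B : Set ℓ′} (F : List A → B) (r : ℕ) where

  open MonoidSolver (++-monoid A) using (solve; _⊕_; _⊜_)

  Valid : List A → Set ℓ
  Valid w = Unique w × length w ≡ r

  Valid-resp-↭ : ∀ {v w} → v ↭ w → Valid v → Valid w
  Valid-resp-↭ p (u , l) = Unique-resp-↭ p u , trans (sym (↭-length p)) l

  infix 4 _~_

  -- Only words of `r` distinct letters have to be compared. The permutation carries validity along
  -- a chain of moves.
  record _~_ (v w : List A) : Set (ℓ ⊔ ℓ′) where
    constructor mk~
    field
      perm : v ↭ w
      eq   : Valid v → F v ≡ F w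

  open _~_ public

  ~-refl : ∀ {v} → v ~ v
  ~-refl = mk~ ↭-refl (λ _ → refl)

  ~-sym : ∀ {v w} → v ~ w → w ~ v
  ~-sym (mk~ p e) = mk~ (↭-sym p) (λ valid → sym (e (Valid-resp-↭ (↭-sym p) valid)))

  ~-trans : ∀ {u v w} → u ~ v → v ~ w → u ~ w
  ~-trans (mk~ p e) (mk~ q f) =
    mk~ (↭-trans p q) (λ valid → trans (e valid) (f (Valid-resp-↭ p valid)))

  assuming-valid : ∀ {v w} → v ↭ w → (Valid v → v ~ w) → v ~ w
  assuming-valid p f = mk~ p (λ valid → eq (f valid) valid)

  module ~-Reasoning where
    infixr 2 _~⟨_⟩_ _≈⟨_⟩_
    infix 3 _∎
    _~⟨_⟩_ : ∀ u {v w} → u ~ v → v ~ w → u ~ w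
    _ ~⟨ p ⟩ q = ~-trans p q
    _≈⟨_⟩_ : ∀ u {v w} → u ≡ v → v ~ w → u ~ w
    _ ≈⟨ refl ⟩ q = q
    _∎ : ∀ w → w ~ w
    _ ∎ = ~-refl

  open ~-Reasoning

  At : ℕ → List A → List A → Set (ℓ ⊔ ℓ′)
  At b L L′ = ∀ X Y → length X ≡ b → X ++ L ++ Y ~ X ++ L′ ++ Y

  -- `At` quantifies over words of every length; the bound places the block inside a word of `r`
  -- letters, so that `room` finds enough letters behind a shorter segment.
  Rot : ℕ → ℕ → Set (ℓ ⊔ ℓ′)
  Rot b m = b + suc m ≤ r × (∀ x Y → length Y ≡ m → At b (x ∷ Y) (Y ∷ʳ x))

  Swap : ℕ → Set (ℓ ⊔ ℓ′)
  Swap b = ∀ x y → At b (x ∷ y ∷ []) (y ∷ x ∷ [])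

  Cycle₃ : ℕ → Set (ℓ ⊔ ℓ′)
  Cycle₃ b = ∀ x y z → At b (x ∷ y ∷ z ∷ []) (y ∷ z ∷ x ∷ [])

  Rot₁⇒Swap : ∀ {b} → Rot b 1 → Swap b
  Rot₁⇒Swap (_ , rot) x y = rot x [ y ] refl

  Rot₂⇒Cycle₃ : ∀ {b} → Rot b 2 → Cycle₃ b
  Rot₂⇒Cycle₃ (_ , rot) x y z = rot x (y ∷ z ∷ []) refl

  room : ∀ X L {Y b k m} → Valid (X ++ L ++ Y) → length X ≡ b → length L ≡ k →
         b + (k + m) ≤ r → m ≤ length Y
  room X L {Y} (_ , refl) refl refl le =
    +-cancelˡ-≤ (length L) _ _ (+-cancelˡ-≤ (length X) _ _ (≤-trans le (≤-reflexive
      (trans (length-++ X) (cong (length X +_) (length-++ L))))))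

  -- The blocks end at the same place. Rotating `x` to the end of the longer one and back to the
  -- front of the shorter one moves it past `y` alone.
  nested-left : ∀ {b m} → Rot b (suc m) → Rot (suc b) m → Swap b
  nested-left {b} {m} (le , rot) (_ , rot′) x y X Y lX =
    assuming-valid (++⁺ˡ X (swap x y ↭-refl)) go
    where
    go : Valid (X ++ x ∷ y ∷ Y) → X ++ x ∷ y ∷ Y ~ X ++ y ∷ x ∷ Y
    go valid with split-at m Y (room X (x ∷ y ∷ []) valid lX refl le)
    ... | U , V , refl , lU =
      X ++ x ∷ y ∷ U ++ V       ~⟨ rot x (y ∷ U) (cong suc lU) X V lX ⟩
      X ++ (y ∷ U ∷ʳ x) ++ V    ≈⟨ solve 5 (λ x y X U V → X ⊕ (y ⊕ U ⊕ x) ⊕ V ⊜ (X ⊕ y) ⊕ (U ⊕ x) ⊕ V) refl [ x ] [ y ] X U V ⟩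
      (X ∷ʳ y) ++ (U ∷ʳ x) ++ V ~⟨ ~-sym (rot′ x U lU (X ∷ʳ y) V (trans (length-++ X) (trans (+-comm (length X) 1) (cong suc lX)))) ⟩
      (X ∷ʳ y) ++ x ∷ U ++ V    ≈⟨ ++-assoc X [ y ] _ ⟩
      X ++ y ∷ x ∷ U ++ V       ∎

  -- The mirror image: the blocks begin at the same place, and `x` returns from the front to a place
  -- behind `y`.
  nested-right : ∀ {b m} → Rot b m → Rot b (suc m) → Swap (b + m)
  nested-right {b} (_ , rot) (_ , rot′) x y X Y lX with split-+ b X lX
  ... | U , V , refl , lU , lV =
    (U ++ V) ++ x ∷ y ∷ Y          ≈⟨ solve 5 (λ x y U V Y → (U ⊕ V) ⊕ (x ⊕ y ⊕ Y) ⊜ U ⊕ (V ⊕ x) ⊕ (y ⊕ Y)) refl [ x ] [ y ] U V Y ⟩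
    U ++ (V ∷ʳ x) ++ y ∷ Y         ~⟨ ~-sym (rot x V lV U (y ∷ Y) lU) ⟩
    U ++ (x ∷ V) ++ y ∷ Y          ≈⟨ solve 5 (λ x y U V Y → U ⊕ (x ⊕ V) ⊕ (y ⊕ Y) ⊜ U ⊕ (x ⊕ V ⊕ y) ⊕ Y) refl [ x ] [ y ] U V Y ⟩
    U ++ (x ∷ (V ∷ʳ y)) ++ Y       ~⟨ rot′ x (V ∷ʳ y) (trans (length-++ V) (trans (+-comm (length V) 1) (cong suc lV))) U Y lU ⟩
    U ++ ((V ∷ʳ y) ∷ʳ x) ++ Y      ≈⟨ solve 5 (λ x y U V Y → U ⊕ ((V ⊕ y) ⊕ x) ⊕ Y ⊜ (U ⊕ V) ⊕ (y ⊕ x ⊕ Y)) refl [ x ] [ y ] U V Y ⟩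
    (U ++ V) ++ y ∷ x ∷ Y          ∎

  -- Conjugating by a rotation translates a local move within the rotated segment.
  module _ {b m k : ℕ} (ro : Rot b m) {L L′ : List A} (L↭L′ : L ↭ L′) (lL : length L ≡ k) where

    private
      rot = proj₂ ro
      lL′ : length L′ ≡ k
      lL′ = trans (sym (↭-length L↭L′)) lL

      inner : ∀ {s} U V → length U ≡ s → length V ≡ m ∸ (s + k) → s + k ≤ m →
              length (U ++ L ++ V) ≡ m × length (U ++ L′ ++ V) ≡ m
      inner {s} U V lU lV le = len L lL , len L′ lL′
        where
        len : ∀ M → length M ≡ k → length (U ++ M ++ V) ≡ m
        len M lM rewrite length-++ U {M ++ V} | length-++ M {V} | lU | lM | lV =
            trans (sym (+-assoc s k _)) (m+[n∸m]≡n le)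

    translate-up : ∀ {s} → s + k ≤ m → At (b + s) L L′ → At (suc (b + s)) L L′
    translate-up {s} le at X Y lX = assuming-valid (zoom X L↭L′) go
      where
      go : Valid (X ++ L ++ Y) → X ++ L ++ Y ~ X ++ L′ ++ Y
      go valid with split-+ b X (trans lX (sym (+-suc b s)))
                  | split-at (m ∸ (s + k)) Y (room X L valid lX lL (≤-trans (≤-reflexive bound) (proj₁ ro)))
        where
        bound : suc (b + s) + (k + (m ∸ (s + k))) ≡ b + suc m
        bound = trans (cong suc (trans (+-assoc b s _) (cong (b +_) (trans (sym (+-assoc s k _)) (m+[n∸m]≡n le)))))
                      (sym (+-suc b m))
      ... | X₀ , x ∷ U , refl , lX₀ , lU | V , Y₀ , refl , lV with inner U V (suc-injective lU) lV le
      ... | len , len′ =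
        (X₀ ++ x ∷ U) ++ L ++ V ++ Y₀   ≈⟨ solve 6 (λ x X U L V Y → (X ⊕ x ⊕ U) ⊕ L ⊕ V ⊕ Y ⊜ X ⊕ (x ⊕ U ⊕ L ⊕ V) ⊕ Y) refl [ x ] X₀ U L V Y₀ ⟩
        X₀ ++ (x ∷ U ++ L ++ V) ++ Y₀   ~⟨ rot x (U ++ L ++ V) len X₀ Y₀ lX₀ ⟩
        X₀ ++ ((U ++ L ++ V) ∷ʳ x) ++ Y₀ ≈⟨ solve 6 (λ x X U L V Y → X ⊕ ((U ⊕ L ⊕ V) ⊕ x) ⊕ Y ⊜ (X ⊕ U) ⊕ L ⊕ (V ⊕ x ⊕ Y)) refl [ x ] X₀ U L V Y₀ ⟩
        (X₀ ++ U) ++ L ++ (V ++ x ∷ Y₀) ~⟨ at (X₀ ++ U) _ (trans (length-++ X₀) (cong₂ _+_ lX₀ (suc-injective lU))) ⟩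
        (X₀ ++ U) ++ L′ ++ (V ++ x ∷ Y₀) ≈⟨ solve 6 (λ x X U L V Y → (X ⊕ U) ⊕ L ⊕ (V ⊕ x ⊕ Y) ⊜ X ⊕ ((U ⊕ L ⊕ V) ⊕ x) ⊕ Y) refl [ x ] X₀ U L′ V Y₀ ⟩
        X₀ ++ ((U ++ L′ ++ V) ∷ʳ x) ++ Y₀ ~⟨ ~-sym (rot x (U ++ L′ ++ V) len′ X₀ Y₀ lX₀) ⟩
        X₀ ++ (x ∷ U ++ L′ ++ V) ++ Y₀  ≈⟨ solve 6 (λ x X U L V Y → X ⊕ (x ⊕ U ⊕ L ⊕ V) ⊕ Y ⊜ (X ⊕ x ⊕ U) ⊕ L ⊕ V ⊕ Y) refl [ x ] X₀ U L′ V Y₀ ⟩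
        (X₀ ++ x ∷ U) ++ L′ ++ V ++ Y₀  ∎

    translate-down : ∀ {s} → s + k ≤ m → At (suc (b + s)) L L′ → At (b + s) L L′
    translate-down {s} le at X Y lX = assuming-valid (zoom X L↭L′) go
      where
      go : Valid (X ++ L ++ Y) → X ++ L ++ Y ~ X ++ L′ ++ Y
      go valid with split-+ b X lX
                  | split-at (suc (m ∸ (s + k))) Y (room X L valid lX lL (≤-trans (≤-reflexive bound) (proj₁ ro)))
        where
        bound : (b + s) + (k + suc (m ∸ (s + k))) ≡ b + suc m
        bound = trans (+-assoc b s _) (cong (b +_) (trans (sym (+-assoc s k _))
                  (trans (+-suc (s + k) _) (cong suc (m+[n∸m]≡n le)))))
      ... | X₀ , U , refl , lX₀ , lU | V₀ , Y₀ , refl , lV₀ with split-+ (m ∸ (s + k)) V₀ (trans lV₀ (+-comm 1 _))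
      ... | V , x ∷ [] , refl , lV , _ with inner U V lU lV le
      ... | len , len′ =
        (X₀ ++ U) ++ L ++ (V ∷ʳ x) ++ Y₀ ≈⟨ solve 6 (λ x X U L V Y → (X ⊕ U) ⊕ L ⊕ (V ⊕ x) ⊕ Y ⊜ X ⊕ ((U ⊕ L ⊕ V) ⊕ x) ⊕ Y) refl [ x ] X₀ U L V Y₀ ⟩
        X₀ ++ ((U ++ L ++ V) ∷ʳ x) ++ Y₀ ~⟨ ~-sym (rot x (U ++ L ++ V) len X₀ Y₀ lX₀) ⟩
        X₀ ++ (x ∷ U ++ L ++ V) ++ Y₀    ≈⟨ solve 6 (λ x X U L V Y → X ⊕ (x ⊕ U ⊕ L ⊕ V) ⊕ Y ⊜ (X ⊕ x ⊕ U) ⊕ L ⊕ V ⊕ Y) refl [ x ] X₀ U L V Y₀ ⟩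
        (X₀ ++ x ∷ U) ++ L ++ V ++ Y₀    ~⟨ at (X₀ ++ x ∷ U) _ (trans (length-++ X₀) (trans (cong₂ _+_ lX₀ (cong suc lU)) (+-suc b s))) ⟩
        (X₀ ++ x ∷ U) ++ L′ ++ V ++ Y₀   ≈⟨ solve 6 (λ x X U L V Y → (X ⊕ x ⊕ U) ⊕ L ⊕ V ⊕ Y ⊜ X ⊕ (x ⊕ U ⊕ L ⊕ V) ⊕ Y) refl [ x ] X₀ U L′ V Y₀ ⟩
        X₀ ++ (x ∷ U ++ L′ ++ V) ++ Y₀   ~⟨ rot x (U ++ L′ ++ V) len′ X₀ Y₀ lX₀ ⟩
        X₀ ++ ((U ++ L′ ++ V) ∷ʳ x) ++ Y₀ ≈⟨ solve 6 (λ x X U L V Y → X ⊕ ((U ⊕ L ⊕ V) ⊕ x) ⊕ Y ⊜ (X ⊕ U) ⊕ L ⊕ (V ⊕ x) ⊕ Y) refl [ x ] X₀ U L′ V Y₀ ⟩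
        (X₀ ++ U) ++ L′ ++ (V ∷ʳ x) ++ Y₀ ∎

    translate : ∀ s t → s + k ≤ suc m → t + k ≤ suc m → At (b + s) L L′ → At (b + t) L L′
    translate s t s≤ t≤ at = up t t≤ (down s s≤ at)
      where
      down : ∀ s → s + k ≤ suc m → At (b + s) L L′ → At (b + 0) L L′
      down zero    _        at = at
      down (suc s) (s≤s le) at =
        down s (m≤n⇒m≤1+n le) (translate-down le (subst (λ c → At c L L′) (+-suc b s) at))
      up : ∀ t → t + k ≤ suc m → At (b + 0) L L′ → At (b + t) L L′
      up zero    _        at = at
      up (suc t) (s≤s le) at =
        subst (λ c → At c L L′) (sym (+-suc b t)) (translate-up le (up t (m≤n⇒m≤1+n le) at))

  Swap-translate : ∀ {b m} → Rot b m → ∀ {s t} → s < m → t < m → Swap (b + s) → Swap (b + t)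
  Swap-translate ro {s} {t} s<m t<m sw x y =
    translate ro (swap x y ↭-refl) refl s t (2≤ s s<m) (2≤ t t<m) (sw x y)
    where
    2≤ : ∀ s {m} → s < m → s + 2 ≤ suc m
    2≤ s lt = ≤-trans (≤-reflexive (+-comm s 2)) (s≤s lt)

  Cycle₃-translate : ∀ {b m} → Rot b m → ∀ {t} → 2 ≤ m → suc t < m → Cycle₃ b → Cycle₃ (b + t)
  Cycle₃-translate {b} ro {t} 2≤m t<m cy x y z =
    translate ro (∷↭∷ʳ x (y ∷ z ∷ [])) refl 0 t (s≤s 2≤m) (≤-trans (≤-reflexive (+-comm t 3)) (s≤s t<m))
      (subst (λ c → At c (x ∷ y ∷ z ∷ []) (y ∷ z ∷ x ∷ [])) (sym (+-identityʳ b)) (cy x y z))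

  at-behind : ∀ {b c L L′} → At c L L′ → ∀ X Z Y → length X ≡ b → c ≡ b + length Z →
              X ++ Z ++ L ++ Y ~ X ++ Z ++ L′ ++ Y
  at-behind {L = L} {L′} at X Z Y refl refl =
    X ++ Z ++ L ++ Y     ≈⟨ sym (++-assoc X Z _) ⟩
    (X ++ Z) ++ L ++ Y   ~⟨ at (X ++ Z) Y (length-++ X) ⟩
    (X ++ Z) ++ L′ ++ Y  ≈⟨ ++-assoc X Z _ ⟩
    X ++ Z ++ L′ ++ Y    ∎

  private
    1+ : ∀ b → suc b ≡ b + 1
    1+ b = +-comm 1 b
    2+ : ∀ b → suc (suc b) ≡ b + 2
    2+ b = +-comm 2 b

  -- Conjugating the swap by the 3-cycle shifts it by one place.
  Swap-suc : ∀ {b} → Swap b → Cycle₃ b → Swap (suc b)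
  Swap-suc {b} sw cy y z X Y lX with split-+ b X (trans lX (1+ b))
  ... | X₀ , x ∷ [] , refl , lX₀ , _ =
    (X₀ ∷ʳ x) ++ y ∷ z ∷ Y   ≈⟨ ++-assoc X₀ _ _ ⟩
    X₀ ++ x ∷ y ∷ z ∷ Y      ~⟨ cy x y z X₀ Y lX₀ ⟩
    X₀ ++ y ∷ z ∷ x ∷ Y      ~⟨ sw y z X₀ _ lX₀ ⟩
    X₀ ++ z ∷ y ∷ x ∷ Y      ~⟨ ~-sym (cy x z y X₀ Y lX₀) ⟩
    X₀ ++ x ∷ z ∷ y ∷ Y      ≈⟨ sym (++-assoc X₀ _ _) ⟩
    (X₀ ∷ʳ x) ++ z ∷ y ∷ Y   ∎

  -- A transposition and a 3-cycle with just one common place generate the symmetric group on four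
  -- places. The bound provides the fourth letter.
  Swap-suc′ : ∀ {b} → b + 4 ≤ r → Swap b → Cycle₃ (suc b) → Swap (suc b)
  Swap-suc′ {b} le sw cy x y X Y lX = assuming-valid (++⁺ˡ X (swap x y ↭-refl)) go
    where
    go : Valid (X ++ x ∷ y ∷ Y) → X ++ x ∷ y ∷ Y ~ X ++ y ∷ x ∷ Y
    go valid with split-+ b X (trans lX (1+ b))
                | split-at 1 Y (room X (x ∷ y ∷ []) valid lX refl (≤-trans (≤-reflexive (sym (+-suc b 3))) le))
    ... | X₀ , w ∷ [] , refl , lX₀ , _ | z ∷ [] , Z , refl , _ =
      (X₀ ∷ʳ w) ++ x ∷ y ∷ z ∷ Z   ≈⟨ ++-assoc X₀ _ _ ⟩
      X₀ ++ w ∷ x ∷ y ∷ z ∷ Z      ~⟨ sw w x X₀ _ lX₀ ⟩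
      X₀ ++ x ∷ w ∷ y ∷ z ∷ Z      ~⟨ at-behind (cy w y z) X₀ [ x ] Z lX₀ (1+ b) ⟩
      X₀ ++ x ∷ y ∷ z ∷ w ∷ Z      ~⟨ sw x y X₀ _ lX₀ ⟩
      X₀ ++ y ∷ x ∷ z ∷ w ∷ Z      ~⟨ ~-sym (at-behind (cy w x z) X₀ [ y ] Z lX₀ (1+ b)) ⟩
      X₀ ++ y ∷ w ∷ x ∷ z ∷ Z      ~⟨ sw y w X₀ _ lX₀ ⟩
      X₀ ++ w ∷ y ∷ x ∷ z ∷ Z      ≈⟨ sym (++-assoc X₀ _ _) ⟩
      (X₀ ∷ʳ w) ++ y ∷ x ∷ z ∷ Z   ∎

  Swap-pred : ∀ {b} → b + 3 ≤ r → Swap (suc b) → Cycle₃ b → Swap b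
  Swap-pred {b} le sw cy x y X Y lX = assuming-valid (++⁺ˡ X (swap x y ↭-refl)) go
    where
    go : Valid (X ++ x ∷ y ∷ Y) → X ++ x ∷ y ∷ Y ~ X ++ y ∷ x ∷ Y
    go valid with split-at 1 Y (room X (x ∷ y ∷ []) valid lX refl le)
    ... | z ∷ [] , Z , refl , _ =
      X ++ x ∷ y ∷ z ∷ Z  ~⟨ cy x y z X Z lX ⟩
      X ++ y ∷ z ∷ x ∷ Z  ~⟨ at-behind (sw z x) X [ y ] Z lX (1+ b) ⟩
      X ++ y ∷ x ∷ z ∷ Z  ∎

  -- Again the transposition and the 3-cycle share one of four places, now the place `b + 2`.
  Swap-pred′ : ∀ {b} → b + 4 ≤ r → Swap (suc (suc b)) → Cycle₃ b → Swap (suc b)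
  Swap-pred′ {b} le sw cy x y X Y lX = assuming-valid (++⁺ˡ X (swap x y ↭-refl)) go
    where
    go : Valid (X ++ x ∷ y ∷ Y) → X ++ x ∷ y ∷ Y ~ X ++ y ∷ x ∷ Y
    go valid with split-+ b X (trans lX (1+ b))
                | split-at 1 Y (room X (x ∷ y ∷ []) valid lX refl (≤-trans (≤-reflexive (sym (+-suc b 3))) le))
    ... | X₀ , w ∷ [] , refl , lX₀ , _ | z ∷ [] , Z , refl , _ =
      (X₀ ∷ʳ w) ++ x ∷ y ∷ z ∷ Z   ≈⟨ ++-assoc X₀ _ _ ⟩
      X₀ ++ w ∷ x ∷ y ∷ z ∷ Z      ~⟨ at-behind (sw y z) X₀ (w ∷ x ∷ []) Z lX₀ (2+ b) ⟩
      X₀ ++ w ∷ x ∷ z ∷ y ∷ Z      ~⟨ cy w x z X₀ _ lX₀ ⟩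
      X₀ ++ x ∷ z ∷ w ∷ y ∷ Z      ~⟨ at-behind (sw w y) X₀ (x ∷ z ∷ []) Z lX₀ (2+ b) ⟩
      X₀ ++ x ∷ z ∷ y ∷ w ∷ Z      ~⟨ ~-sym (cy y x z X₀ _ lX₀) ⟩
      X₀ ++ y ∷ x ∷ z ∷ w ∷ Z      ~⟨ at-behind (sw z w) X₀ (y ∷ x ∷ []) Z lX₀ (2+ b) ⟩
      X₀ ++ y ∷ x ∷ w ∷ z ∷ Z      ~⟨ ~-sym (cy w y x X₀ _ lX₀) ⟩
      X₀ ++ w ∷ y ∷ x ∷ z ∷ Z      ≈⟨ sym (++-assoc X₀ _ _) ⟩
      (X₀ ∷ʳ w) ++ y ∷ x ∷ z ∷ Z   ∎

  -- Two 3-cycles with one common place generate the alternating group on five places, which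
  -- contains the product of two disjoint transpositions. The letter `v` returns to its place.
  double-swap : ∀ {b} → Cycle₃ b → Cycle₃ (suc (suc b)) → ∀ v w x y z →
                At b (v ∷ w ∷ x ∷ y ∷ z ∷ []) (v ∷ x ∷ w ∷ z ∷ y ∷ [])
  double-swap {b} cy cy′ v w x y z X Y lX =
    X ++ v ∷ w ∷ x ∷ y ∷ z ∷ Y  ~⟨ at-behind (cy′ x y z) X (v ∷ w ∷ []) Y lX (2+ b) ⟩
    X ++ v ∷ w ∷ y ∷ z ∷ x ∷ Y  ~⟨ ~-sym (cy y v w X _ lX) ⟩
    X ++ y ∷ v ∷ w ∷ z ∷ x ∷ Y  ~⟨ ~-sym (at-behind (cy′ x w z) X (y ∷ v ∷ []) Y lX (2+ b)) ⟩
    X ++ y ∷ v ∷ x ∷ w ∷ z ∷ Y  ~⟨ cy y v x X _ lX ⟩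
    X ++ v ∷ x ∷ y ∷ w ∷ z ∷ Y  ~⟨ at-behind (cy′ y w z) X (v ∷ x ∷ []) Y lX (2+ b) ⟩
    X ++ v ∷ x ∷ w ∷ z ∷ y ∷ Y  ∎

  move-to-front : ∀ X y S {Y} → (∀ t → t < length S → Swap (length X + t)) →
                  X ++ S ++ y ∷ Y ~ X ++ y ∷ S ++ Y
  move-to-front X y []      _  = ~-refl
  move-to-front X y (s ∷ S) {Y} sw =
    X ++ s ∷ S ++ y ∷ Y      ≈⟨ sym (++-assoc X [ s ] _) ⟩
    (X ∷ʳ s) ++ S ++ y ∷ Y   ~⟨ move-to-front (X ∷ʳ s) y S sw′ ⟩
    (X ∷ʳ s) ++ y ∷ S ++ Y   ≈⟨ ++-assoc X [ s ] _ ⟩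
    X ++ s ∷ y ∷ S ++ Y      ~⟨ sw 0 (s≤s z≤n) s y X _ (sym (+-identityʳ _)) ⟩
    X ++ y ∷ s ∷ S ++ Y      ∎
    where
    sw′ : ∀ t → t < length S → Swap (length (X ∷ʳ s) + t)
    sw′ t t< = subst Swap (sym (∷ʳ-+ X s t)) (sw (suc t) (s≤s t<))

  -- Selection sort: a letter is moved to its place across swappable gaps only, because across
  -- any other gap the letters that have to precede it already do.
  sort : ∀ X {S T} → S ↭ T → Unique S →
         (∀ t → suc t < length S →
           Swap (length X + t) ⊎ (∀ {y} → y ∈ take (suc t) T → y ∈ take (suc t) S)) →
         X ++ S ~ X ++ T
  sort X {S} {[]}    S↭T _ _ = mk~ (++⁺ˡ X S↭T) λ _ → cong (λ S → F (X ++ S)) (↭-empty-inv S↭T)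
  sort X {S} {y ∷ T} S↭T S! gap with ∈-∃++ (∈-resp-↭ (↭-sym S↭T) (here refl))
  ... | S₁ , S₂ , refl =
    X ++ S₁ ++ y ∷ S₂       ~⟨ move-to-front X y S₁ front ⟩
    X ++ y ∷ S₁ ++ S₂       ≈⟨ sym (++-assoc X [ y ] _) ⟩
    (X ∷ʳ y) ++ S₁ ++ S₂    ~⟨ sort (X ∷ʳ y) rest rest! gap′ ⟩
    (X ∷ʳ y) ++ T           ≈⟨ ++-assoc X [ y ] _ ⟩
    X ++ y ∷ T              ∎
    where
    yS! : Unique (y ∷ S₁ ++ S₂)
    yS! = Unique-resp-↭ (shift y S₁ S₂) S!
    rest! : Unique (S₁ ++ S₂)
    rest! = tail yS!
    y∉S : y ∉ S₁ ++ S₂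
    y∉S = Unique[x∷xs]⇒x∉xs yS!
    rest : S₁ ++ S₂ ↭ T
    rest = drop-∷ (↭-trans (↭-sym (shift y S₁ S₂)) S↭T)
    late : ∀ {t} → y ∈ take t (S₁ ++ y ∷ S₂) → ¬ (t ≤ length S₁)
    late y∈ t≤ = y∉S (∈-++⁺ˡ (∈-take-++ S₁ t≤ y∈))
    len : length (S₁ ++ y ∷ S₂) ≡ suc (length (S₁ ++ S₂))
    len = ↭-length (shift y S₁ S₂)
    front : ∀ t → t < length S₁ → Swap (length X + t)
    front t t< with gap t (subst (suc t <_) (sym len) (s≤s (≤-trans t< (length-++-≤ˡ S₁))))
    ... | inj₁ sw = sw
    ... | inj₂ h  = ⊥-elim (late (h (here refl)) t<)
    gap′ : ∀ t → suc t < length (S₁ ++ S₂) →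
           Swap (length (X ∷ʳ y) + t) ⊎ (∀ {z} → z ∈ take (suc t) T → z ∈ take (suc t) (S₁ ++ S₂))
    gap′ t t< with gap (suc t) (subst (2 + t <_) (sym len) (s≤s t<))
    ... | inj₁ sw = inj₁ (subst Swap (sym (∷ʳ-+ X y t)) sw)
    ... | inj₂ h  = inj₂ λ z∈ → ∈-take-delete S₁ (≤-pred (≰⇒> (late (h (here refl)))))
                      (λ { refl → y∉S (∈-resp-↭ (↭-sym rest) (∈-take (suc t) z∈)) }) (h (there z∈))

-- Removing repetitions

module Dedup {A : Set} (_≟_ : DecidableEquality A) where

  dedup : List A → List A
  dedup = deduplicate _≟_

  dedup-unique : ∀ {w} → Unique w → dedup w ≡ w
  dedup-unique []        = refl
  dedup-unique (x∉ ∷ w!) = cong (_ ∷_)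
    (trans (cong (filter _) (dedup-unique w!)) (filter-all _ x∉))

  private
    filter-comm : ∀ {p q} {Q : A → Set p} {R : A → Set q} (Q? : ∀ x → Dec (Q x)) (R? : ∀ x → Dec (R x)) X →
                  filter Q? (filter R? X) ≡ filter R? (filter Q? X)
    filter-comm Q? R? []      = refl
    filter-comm Q? R? (x ∷ X) with does (Q? x) in q | does (R? x) in r
    ... | true  | true  rewrite q | r = cong (x ∷_) (filter-comm Q? R? X)
    ... | true  | false rewrite r = filter-comm Q? R? X
    ... | false | true  rewrite q = filter-comm Q? R? X
    ... | false | false = filter-comm Q? R? X

    filter-dedup : ∀ X {y Z} → filter (λ z → ¬? (y ≟ z)) (dedup (X ++ y ∷ Z)) ≡
                               filter (λ z → ¬? (y ≟ z)) (dedup (X ++ Z))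
    filter-dedup [] {y} {Z} with y ≟ y
    ... | yes _  = filter-idem (λ z → ¬? (y ≟ z)) (dedup Z)
    ... | no y≢y = ⊥-elim (y≢y refl)
    filter-dedup (x ∷ X) {y} {Z} with does (y ≟ x)
    ... | true  = trans (filter-comm _ _ (dedup (X ++ y ∷ Z)))
                    (trans (cong (filter _) (filter-dedup X)) (filter-comm _ _ (dedup (X ++ Z))))
    ... | false = cong (x ∷_) (trans (filter-comm _ _ (dedup (X ++ y ∷ Z)))
                    (trans (cong (filter _) (filter-dedup X)) (filter-comm _ _ (dedup (X ++ Z)))))

  dedup-repeat : ∀ {X y Z} → y ∈ X → dedup (X ++ y ∷ Z) ≡ dedup (X ++ Z)
  dedup-repeat {x ∷ X} (here refl) = cong (x ∷_) (filter-dedup X)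
  dedup-repeat {x ∷ X} (there y∈)  = cong (x ∷_) (cong (filter _) (dedup-repeat y∈))

-- Letters on positions and the two readings

module Reading {A : Set} (_≟ᴬ_ : DecidableEquality A) {P : Set} (_≟_ : DecidableEquality P) where

  open Order _≟_

  open Dedup _≟ᴬ_

  dedup-map-repeat : ∀ (u : P → A) X {i j Y} → i ∈ X → u i ≡ u j →
                     dedup (map u (X ++ j ∷ Y)) ≡ dedup (map u (X ++ Y))
  dedup-map-repeat u X {i} {j} {Y} i∈ eq =
    trans (cong dedup (map-++ u X (j ∷ Y)))
      (trans (dedup-repeat (subst (_∈ map u X) eq (∈-map⁺ u i∈)))
             (cong dedup (sym (map-++ u X Y))))

  infixl 6 _∖_

  _∖_ : List P → P → List P
  xs ∖ i = filter (λ j → ¬? (i ≟ j)) xs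

  ∖-split : ∀ X {i Y} → Unique (X ++ i ∷ Y) → (X ++ i ∷ Y) ∖ i ≡ X ++ Y
  ∖-split X {i} {Y} X! = begin
    (X ++ i ∷ Y) ∖ i      ≡⟨ filter-++ _ X (i ∷ Y) ⟩
    X ∖ i ++ (i ∷ Y) ∖ i  ≡⟨ cong₂ _++_ (filter-all _ X≢) (filter-reject (λ j → ¬? (i ≟ j)) (λ i≢i → i≢i refl)) ⟩
    X ++ Y ∖ i            ≡⟨ cong (X ++_) (filter-all _ Y≢) ⟩
    X ++ Y                ∎
    where
    open ≡-Reasoning
    X≢ : All (i ≢_) X
    X≢ = All.tabulate λ j∈ i≡j → ≢-split X X! (∈-++⁺ˡ j∈) (sym i≡j)
    Y≢ : All (i ≢_) Y
    Y≢ = All.tabulate λ j∈ i≡j → ≢-split X X! (∈-++⁺ʳ X j∈) (sym i≡j)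

  infixl 6 _[_↦_]

  _[_↦_] : (P → A) → P → A → P → A
  (u [ i ↦ x ]) j = if does (i ≟ j) then x else u j

  ↦-here : ∀ u i x → (u [ i ↦ x ]) i ≡ x
  ↦-here u i x with i ≟ i
  ... | yes _  = refl
  ... | no i≢i = ⊥-elim (i≢i refl)

  ↦-there : ∀ u {i j} x → j ≢ i → (u [ i ↦ x ]) j ≡ u j
  ↦-there u {i} {j} x j≢i with i ≟ j
  ... | yes i≡j = ⊥-elim (j≢i (sym i≡j))
  ... | no _    = refl

  map-↦ : ∀ u {i} x X → (∀ {j} → j ∈ X → j ≢ i) → map (u [ i ↦ x ]) X ≡ map u X
  map-↦ u x []      _  = refl
  map-↦ u x (j ∷ X) ≢i = cong₂ _∷_ (↦-there u x (≢i (here refl))) (map-↦ u x X (≢i ∘ there))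

  assign : List P → A → List A → P → A
  assign []       d _       _ = d
  assign (_ ∷ _)  d []      _ = d
  assign (i ∷ ps) d (x ∷ w) = assign ps d w [ i ↦ x ]

  map-assign : ∀ ps d w → Unique ps → length w ≡ length ps → map (assign ps d w) ps ≡ w
  map-assign []       d []      _           _  = refl
  map-assign (i ∷ ps) d (x ∷ w) ps!@(_ ∷ t) eq = cong₂ _∷_ (↦-here (assign ps d w) i x)
    (trans (map-↦ (assign ps d w) x ps (≢-split [] ps!)) (map-assign ps d w t (suc-injective eq)))

  module Connected {ℓ} {B : Set ℓ} (F G : List A → B) where

    Connects : List P → List P → Set ℓ
    Connects ps qs = ∀ (u : P → A) → F (dedup (map u ps)) ≡ G (dedup (map u qs))

    -- Giving `j` the letter of `h` makes it a repetition in both readings.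
    drop-repeat : ∀ {ps qs h j} X Y X′ Y′ → ps ≡ X ++ j ∷ Y → qs ≡ X′ ++ j ∷ Y′ → h ∈ X → h ∈ X′ →
                  Unique ps → Unique qs → Connects ps qs → Connects (X ++ Y) (X′ ++ Y′)
    drop-repeat {h = h} {j} X Y X′ Y′ refl refl h∈ h∈′ ps! qs! conn u =
      trans (cong F (sym (side X Y ps! h∈))) (trans (conn u′) (cong G (side X′ Y′ qs! h∈′)))
      where
      u′ = u [ j ↦ u h ]
      side : ∀ X Y → Unique (X ++ j ∷ Y) → h ∈ X → dedup (map u′ (X ++ j ∷ Y)) ≡ dedup (map u (X ++ Y))
      side X Y X! h∈ = trans
        (dedup-map-repeat u′ X h∈ (trans (↦-there u _ (≢-split X X! (∈-++⁺ˡ h∈))) (sym (↦-here u j _))))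
        (cong dedup (map-↦ u _ (X ++ Y) (≢-split X X!)))

    -- When `j` gets the letter of `i`, the first reading loses `j` and the second loses `i`; the
    -- leading `j` of the second then stands for `i`.
    merge-heads : ∀ {i j} X Y X′ Y′ → let ps = i ∷ X ++ j ∷ Y ; qs = j ∷ X′ ++ i ∷ Y′ in
                  Unique ps → Unique qs → Connects ps qs → Connects (i ∷ X ++ Y) (i ∷ X′ ++ Y′)
    merge-heads {i} {j} X Y X′ Y′ ps! qs! conn u = begin
      F (dedup (map u (i ∷ X ++ Y)))        ≡⟨ cong (F ∘ dedup) (sym (map-↦ u _ _ (≢-split (i ∷ X) ps!))) ⟩
      F (dedup (map u′ (i ∷ X ++ Y)))       ≡⟨ cong F (sym (dedup-map-repeat u′ (i ∷ X) (here refl) ui≡uj)) ⟩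
      F (dedup (map u′ (i ∷ X ++ j ∷ Y)))   ≡⟨ conn u′ ⟩
      G (dedup (map u′ (j ∷ X′ ++ i ∷ Y′))) ≡⟨ cong G (dedup-map-repeat u′ (j ∷ X′) (here refl) (sym ui≡uj)) ⟩
      G (dedup (map u′ (j ∷ X′ ++ Y′)))     ≡⟨ cong (G ∘ dedup) (cong₂ _∷_ (↦-here u j _) (map-↦ u _ _ (≢-split [] qs! ∘ rest))) ⟩
      G (dedup (map u (i ∷ X′ ++ Y′)))      ∎
      where
      open ≡-Reasoning
      u′ = u [ j ↦ u i ]
      ui≡uj : u′ i ≡ u′ j
      ui≡uj = trans (↦-there u _ (≢-split (i ∷ X) ps! (here refl))) (sym (↦-here u j _))
      rest : ∀ {k} → k ∈ X′ ++ Y′ → k ∈ X′ ++ i ∷ Y′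
      rest k∈ with ∈-++⁻ X′ k∈
      ... | inj₁ k∈X′ = ∈-++⁺ˡ k∈X′
      ... | inj₂ k∈Y′ = ∈-++⁺ʳ X′ (there k∈Y′)

    -- One repetition: chords as moves of the hole

    module Puzzle {ps qs : List P} {r : ℕ} (ps↭qs : ps ↭ qs) (ps! : Unique ps)
                  (conn : Connects ps qs) (size : length ps ≡ suc r) where

      open Exchange F r

      private
        qs! : Unique qs
        qs! = Unique-resp-↭ ps↭qs ps!

        unique-hole : ∀ (u : P → A) {i j} X X′ {Y Y′} → X ++ j ∷ Y ↭ X′ ++ i ∷ Y′ → u i ≡ u j →
                      map u (X ++ Y) ↭ map u (X′ ++ Y′)
        unique-hole u {i} {j} X X′ {Y} {Y′} p eq = drop-∷ (subst (λ x → x ∷ map u (X ++ Y) ↭ u i ∷ map u (X′ ++ Y′)) (sym eq)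
          (map⁺ u (↭-trans (↭-sym (shift j X Y)) (↭-trans p (shift i X′ Y′)))))

      -- The first reading loses `j`. The second loses `i` if `j` precedes it; if `j` directly
      -- follows `i`, it loses `j`, but deleting either of two equal neighbours gives the same word.
      -- This is why `Link` admits both cases.
      link-eq : ∀ {i j} X Y (u : P → A) → ps ≡ X ++ j ∷ Y → i ∈ X → Link qs i j → u i ≡ u j →
                Unique (map u (X ++ Y)) → F (map u (X ++ Y)) ≡ G (map u (qs ∖ i))
      link-eq {i} {j} X Y u refl i∈ (X′ , Y′ , refl , rel) eq w! = begin
        F (map u (X ++ Y))                 ≡⟨ cong F (sym (dedup-unique w!)) ⟩
        F (dedup (map u (X ++ Y)))         ≡⟨ cong F (sym (dedup-map-repeat u X i∈ eq)) ⟩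
        F (dedup (map u (X ++ j ∷ Y)))     ≡⟨ conn u ⟩
        G (dedup (map u (X′ ++ i ∷ Y′)))   ≡⟨ cong G (right rel) ⟩
        G (dedup (map u (X′ ++ Y′)))       ≡⟨ cong G (dedup-unique (Unique-resp-↭ (unique-hole u X X′ ps↭qs eq) w!)) ⟩
        G (map u (X′ ++ Y′))               ≡⟨ cong (G ∘ map u) (sym (∖-split X′ qs!)) ⟩
        G (map u ((X′ ++ i ∷ Y′) ∖ i))     ∎
        where
        open ≡-Reasoning
        right : ∀ {Y′} → j ∈ X′ ⊎ (∃ λ Z → Y′ ≡ j ∷ Z) →
                dedup (map u (X′ ++ i ∷ Y′)) ≡ dedup (map u (X′ ++ Y′))
        right (inj₁ j∈) = dedup-map-repeat u X′ j∈ (sym eq)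
        right (inj₂ (Z , refl)) = begin
          dedup (map u (X′ ++ i ∷ j ∷ Z))    ≡⟨ cong (dedup ∘ map u) (sym (++-assoc X′ [ i ] _)) ⟩
          dedup (map u ((X′ ∷ʳ i) ++ j ∷ Z)) ≡⟨ dedup-map-repeat u (X′ ∷ʳ i) (∈-++⁺ʳ X′ (here refl)) eq ⟩
          dedup (map u ((X′ ∷ʳ i) ++ Z))     ≡⟨ cong dedup (trans (cong (map u) (++-assoc X′ [ i ] Z)) (map-++ u X′ (i ∷ Z))) ⟩
          dedup (map u X′ ++ u i ∷ map u Z)  ≡⟨ cong (λ x → dedup (map u X′ ++ x ∷ map u Z)) eq ⟩
          dedup (map u X′ ++ u j ∷ map u Z)  ≡⟨ cong dedup (sym (map-++ u X′ (j ∷ Z))) ⟩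
          dedup (map u (X′ ++ j ∷ Z))        ∎

      -- The letter at `i` does not occur in the conclusion and can be chosen as a repetition: that
      -- of `h`, which hides `i` in both readings, or that of the next position `j`, which reduces
      -- the claim to `link-eq`.
      good-eq : ∀ {i} → Good ps qs i → (u : P → A) → Unique (map u (ps ∖ i)) →
                F (map u (ps ∖ i)) ≡ G (map u (qs ∖ i))
      good-eq {i} (inj₁ (h , (X , Y , refl , h∈) , (X′ , Y′ , refl , h∈′))) u w! = begin
        F (map u ((X ++ i ∷ Y) ∖ i))      ≡⟨ cong (F ∘ map u) (∖-split X ps!) ⟩
        F (map u (X ++ Y))                ≡⟨ cong F (sym (dedup-unique wX)) ⟩
        F (dedup (map u (X ++ Y)))        ≡⟨ drop-repeat X Y X′ Y′ refl refl h∈ h∈′ ps! qs! conn u ⟩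
        G (dedup (map u (X′ ++ Y′)))      ≡⟨ cong G (dedup-unique (Unique-resp-↭ (map⁺ u (drop-mid X X′ ps↭qs)) wX)) ⟩
        G (map u (X′ ++ Y′))              ≡⟨ cong (G ∘ map u) (sym (∖-split X′ qs!)) ⟩
        G (map u ((X′ ++ i ∷ Y′) ∖ i))    ∎
        where
        open ≡-Reasoning
        wX : Unique (map u (X ++ Y))
        wX = subst (λ X → Unique (map u X)) (∖-split X ps!) w!
      good-eq {i} (inj₂ (X , j , Y , refl , link)) u w! = begin
        F (map u ((X ++ i ∷ j ∷ Y) ∖ i))  ≡⟨ cong (F ∘ map u) (∖-split X ps!) ⟩
        F (map u (X ++ j ∷ Y))            ≡⟨ cong F shifted ⟩
        F (map u′ ((X ∷ʳ i) ++ Y))        ≡⟨ link-eq (X ∷ʳ i) Y u′ (sym (++-assoc X _ _)) (∈-++⁺ʳ X (here refl)) link ui≡uj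
                                               (subst Unique (trans (cong (map u) (∖-split X ps!)) shifted) w!) ⟩
        G (map u′ (qs ∖ i))               ≡⟨ cong G (map-↦ u _ (qs ∖ i) λ k∈ k≡i → proj₂ (∈-filter⁻ (λ j → ¬? (i ≟ j)) {xs = qs} k∈) (sym k≡i)) ⟩
        G (map u (qs ∖ i))                ∎
        where
        open ≡-Reasoning
        u′ = u [ i ↦ u j ]
        ui≡uj : u′ i ≡ u′ j
        ui≡uj = trans (↦-here u i _) (sym (↦-there u _ (≢-split X ps! (∈-++⁺ʳ X (here refl)))))
        shifted : map u (X ++ j ∷ Y) ≡ map u′ ((X ∷ʳ i) ++ Y)
        shifted = begin
          map u (X ++ j ∷ Y)               ≡⟨ map-++ u X _ ⟩
          map u X ++ u j ∷ map u Y         ≡⟨ cong₂ (λ V W → V ++ u j ∷ W) (sym (map-↦ u _ X λ k∈ → ≢-split X ps! (∈-++⁺ˡ k∈)))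
                                                (sym (map-↦ u _ Y λ k∈ → ≢-split X ps! (∈-++⁺ʳ X (there k∈)))) ⟩
          map u′ X ++ u j ∷ map u′ Y       ≡⟨ cong (λ x → map u′ X ++ x ∷ map u′ Y) (sym (↦-here u i _)) ⟩
          map u′ X ++ map u′ (i ∷ Y)       ≡⟨ sym (map-++ u′ X _) ⟩
          map u′ (X ++ i ∷ Y)              ≡⟨ cong (map u′) (sym (++-assoc X [ i ] Y)) ⟩
          map u′ ((X ∷ʳ i) ++ Y)           ∎

      private
        ++-injective : ∀ (V V′ : List A) {W W′} → length V ≡ length V′ → V ++ W ≡ V′ ++ W′ → V ≡ V′ × W ≡ W′
        ++-injective []      []       _  eq = refl , eq
        ++-injective (x ∷ V) (y ∷ V′) le eq with ∷-injective eq
        ... | refl , eq′ with ++-injective V V′ (suc-injective le) eq′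
        ... | refl , refl = refl , refl

      -- Put `x` at both `i` and `j`. By `link-eq` and `good-eq`, the word along `ps` without `j`
      -- and the one without `i` have the same value under `F`, both being compared with the same
      -- value of `G`. They differ by moving `x` across the block.
      link-rot : ∀ α γ {β i j} → ps ≡ α ++ i ∷ γ ++ j ∷ β → Good ps qs i → Link qs i j →
                 Rot (length α) (length γ)
      link-rot α γ {β} {i} {j} refl good link = bound , rot
        where
        ps-length : length α + suc (length γ + suc (length β)) ≡ suc r
        ps-length = trans (sym (trans (length-++ α) (cong (λ l → length α + suc l) (length-++ γ)))) size
        r-length : r ≡ length α + suc (length γ + length β)
        r-length = suc-injective (trans (sym ps-length) (trans (cong (λ l → length α + suc l) (+-suc _ _)) (+-suc _ _)))
        bound : length α + suc (length γ) ≤ r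
        bound = ≤-trans (+-monoʳ-≤ (length α) (s≤s (m≤m+n _ _))) (≤-reflexive (sym r-length))
        rot : ∀ x V → length V ≡ length γ → At (length α) (x ∷ V) (V ∷ʳ x)
        rot x V lV X Y lX = mk~ (zoom X (∷↭∷ʳ x V)) equal
          where
          equal : Valid (X ++ (x ∷ V) ++ Y) → F (X ++ (x ∷ V) ++ Y) ≡ F (X ++ (V ∷ʳ x) ++ Y)
          equal (w! , lw) with ++-injective (map u α) X (trans (length-map u α) (sym lX))
                                 (trans (sym (map-++ u α _)) (map-assign ps x (X ++ x ∷ V ++ x ∷ Y) ps! lengths))
            where
            lY : length Y ≡ length β
            lY = +-cancelˡ-≡ (length γ) _ _ (suc-injective (+-cancelˡ-≡ (length α) _ _ (trans (sym (trans (length-++ X)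
                   (cong₂ (λ a b → a + suc b) lX (trans (length-++ V) (cong (_+ length Y) lV))))) (trans lw r-length))))
            lengths : length (X ++ x ∷ V ++ x ∷ Y) ≡ length ps
            lengths = trans (length-++ X) (trans (cong₂ (λ a b → a + suc b) lX (trans (length-++ V) (cong₂ (λ a b → a + suc b) lV lY)))
                        (trans ps-length (sym size)))
            u = assign ps x (X ++ x ∷ V ++ x ∷ Y)
          ... | mα , rest with ++-injective (map u γ) V (trans (length-map u γ) (sym lV))
                                 (trans (sym (map-++ u γ _)) (proj₂ (∷-injective rest)))
            where
            u = assign ps x (X ++ x ∷ V ++ x ∷ Y)
          ... | mγ , rest′ = begin
            F (X ++ x ∷ V ++ Y)               ≡⟨ cong F (sym left) ⟩
            F (map u (α ++ i ∷ γ ++ β))       ≡⟨ cong (F ∘ map u) (sym (++-assoc α (i ∷ γ) β)) ⟩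
            F (map u ((α ++ i ∷ γ) ++ β))     ≡⟨ link-eq (α ++ i ∷ γ) β u (sym (++-assoc α (i ∷ γ) _)) (∈-++⁺ʳ α (here refl)) link
                                                   (trans ui (sym uj)) (subst Unique (trans (sym left) (cong (map u) (sym (++-assoc α (i ∷ γ) β)))) w!) ⟩
            G (map u (qs ∖ i))                ≡⟨ sym (good-eq good u (subst Unique (sym right) (Unique-resp-↭ (zoom X (∷↭∷ʳ x V)) w!))) ⟩
            F (map u (ps ∖ i))                ≡⟨ cong F right ⟩
            F (X ++ (V ∷ʳ x) ++ Y)            ∎
            where
            open ≡-Reasoning
            u = assign ps x (X ++ x ∷ V ++ x ∷ Y)
            ui : u i ≡ x
            ui = proj₁ (∷-injective rest)
            uj : u j ≡ x
            uj = proj₁ (∷-injective rest′)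
            mβ : map u β ≡ Y
            mβ = proj₂ (∷-injective rest′)
            left : map u (α ++ i ∷ γ ++ β) ≡ X ++ x ∷ V ++ Y
            left = trans (map-++ u α _) (cong₂ _++_ mα (cong₂ _∷_ ui (trans (map-++ u γ β) (cong₂ _++_ mγ mβ))))
            right : map u (ps ∖ i) ≡ X ++ (V ∷ʳ x) ++ Y
            right = begin
              map u (ps ∖ i)              ≡⟨ cong (map u) (∖-split α ps!) ⟩
              map u (α ++ γ ++ j ∷ β)     ≡⟨ trans (map-++ u α _) (cong₂ _++_ mα (trans (map-++ u γ _) (cong₂ _++_ mγ (cong₂ _∷_ uj mβ)))) ⟩
              X ++ V ++ x ∷ Y             ≡⟨ cong (X ++_) (sym (++-assoc V [ x ] Y)) ⟩
              X ++ (V ∷ʳ x) ++ Y          ∎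

      private
        -- If `k` precedes `i` in `qs`, there is a chord from `i` to `k`. Otherwise `i` precedes `k`
        -- in both orders, so `k` is good and starts a chord to `j`.
        between : ∀ α γ₁ {k} γ₂ {β i j} → ps ≡ α ++ i ∷ (γ₁ ++ k ∷ γ₂) ++ j ∷ β → Good ps qs i → Link qs i j →
                  Rot (length α) (length γ₁) ⊎ Rot (length α + suc (length γ₁)) (length γ₂)
        between α γ₁ {k} γ₂ {β} {i} {j} eq good link with Link-between link k∈ k≢i k≢j
          where
          left : ps ≡ α ++ i ∷ γ₁ ++ k ∷ γ₂ ++ j ∷ β
          left = trans eq (cong (λ X → α ++ i ∷ X) (++-assoc γ₁ _ _))
          right : ps ≡ (α ++ i ∷ γ₁) ++ k ∷ γ₂ ++ j ∷ β
          right = trans left (sym (++-assoc α _ _))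
          k∈ : k ∈ qs
          k∈ = ∈-resp-↭ ps↭qs (subst (k ∈_) (sym right) (∈-++⁺ʳ (α ++ i ∷ γ₁) (here refl)))
          k≢i : k ≢ i
          k≢i = ≢-split α (subst Unique left ps!) (∈-++⁺ʳ α (∈-++⁺ʳ γ₁ (here refl)))
          k≢j : k ≢ j
          k≢j refl = ≢-split (α ++ i ∷ γ₁) (subst Unique right ps!) (∈-++⁺ʳ (α ++ i ∷ γ₁) (∈-++⁺ʳ γ₂ (here refl))) refl
        ... | inj₁ before = inj₁ (link-rot α γ₁ (trans eq (cong (λ X → α ++ i ∷ X) (++-assoc γ₁ _ _))) good (Before⇒Link before))
        ... | inj₂ (before , link′) = inj₂ (subst (λ a → Rot a (length γ₂)) (length-++ α)
              (link-rot (α ++ i ∷ γ₁) γ₂ right (inj₁ (i , (α ++ i ∷ γ₁ , _ , right , ∈-++⁺ʳ α (here refl)) , before)) link′))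
          where
          right : ps ≡ (α ++ i ∷ γ₁) ++ k ∷ γ₂ ++ j ∷ β
          right = trans eq (trans (cong (λ X → α ++ i ∷ X) (++-assoc γ₁ _ _)) (sym (++-assoc α _ _)))

        swaps : ∀ {a m} s → Rot a m → s < m → Swap (a + s) → ∀ t → t < m → Swap (a + t)
        swaps s ro s< sw t t< = Swap-translate ro s< t< sw

        +0 : ∀ {ℓ} (Q : ℕ → Set ℓ) {a} → Q a → Q (a + 0)
        +0 Q = subst Q (sym (+-identityʳ _))

      chord-rot : (c : Chord ps qs) → let open Chord c in Rot (length α) (length γ)
      chord-rot c = link-rot α γ split good link where open Chord c

      Moves : ℕ → ℕ → Set _
      Moves a m = (∀ t → t < m → Swap (a + t)) ⊎ (2 ≤ m × (∀ t → suc t < m → Cycle₃ (a + t)))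

      -- Each position k strictly between the ends i, j of a chord yields a chord from i to k or
      -- one from k to j.  Two consecutive positions of the same kind give a swap; otherwise the
      -- kinds alternate, and the third position from the left gives a 3-cycle.
      chord-moves : (c : Chord ps qs) → let open Chord c in Moves (length α) (length γ)
      chord-moves record { γ = [] } = inj₁ λ _ ()
      chord-moves c@record { γ = k₁ ∷ [] } = inj₁ λ { zero _ → +0 Swap (Rot₁⇒Swap (chord-rot c)) ; (suc _) (s≤s ()) }
      chord-moves c@record { α = α ; γ = γ@(k₁ ∷ k₂ ∷ γ₂) ; split = split ; good = good ; link = link }
        with between α [] (k₂ ∷ γ₂) split good link
      ... | inj₂ high₁ = inj₁ (swaps 0 ro (s≤s z≤n) (+0 Swap (nested-left ro (subst (λ a → Rot a (suc (length γ₂))) (+-comm _ 1) high₁))))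
        where ro = chord-rot c
      ... | inj₁ _ with between α [ k₁ ] γ₂ split good link
      ... | inj₁ low₂  = inj₁ (swaps 0 (chord-rot c) (s≤s z≤n) (+0 Swap (Rot₁⇒Swap low₂)))
      ... | inj₂ high₂ = third γ₂ refl
        where
        ro = chord-rot c
        cycles : Cycle₃ (length α) → Moves (length α) (length γ)
        cycles cy = inj₂ (s≤s (s≤s z≤n) , λ t t< → Cycle₃-translate ro (s≤s (s≤s z≤n)) t< cy)
        third : ∀ γ₃ → γ₂ ≡ γ₃ → Moves (length α) (length γ)
        third [] refl = cycles (Rot₂⇒Cycle₃ ro)
        third (k₃ ∷ γ₃) refl with between α (k₁ ∷ k₂ ∷ []) γ₃ split good link
        ... | inj₁ low₃  = cycles (Rot₂⇒Cycle₃ low₃)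
        ... | inj₂ high₃ = inj₁ (swaps 2 ro (s≤s (s≤s (s≤s z≤n)))
                (nested-left high₂ (subst (λ a → Rot a (length γ₃)) (+-suc (length α) 2) high₃)))

      -- Every inner gap is swappable or a cut

      Movable : ℕ → Set _
      Movable b = Swap b ⊎ Cut ps qs b

      private
        offset : ∀ {a b m} → a ≤ b → suc b ≤ a + m → ∃ λ t → a + t ≡ b × t < m
        offset {a} {b} {m} a≤b b< = b ∸ a , m+[n∸m]≡n a≤b ,
          +-cancelˡ-≤ a _ _ (≤-trans (≤-reflexive (trans (+-suc a _) (cong suc (m+[n∸m]≡n a≤b)))) b<)

        offset′ : ∀ {a b m} → a ≤ b → 2 + b ≤ a + m → ∃ λ t → a + t ≡ b × suc t < m
        offset′ {a} {b} {m} a≤b b< with offset a≤b (<⇒≤ b<)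
        ... | t , refl , _ = t , refl , +-cancelˡ-≤ a _ _ (≤-trans (≤-reflexive (trans (+-suc a _) (cong suc (+-suc a _)))) b<)

        cut-∈ : ∀ {b} (c : Cut ps qs b) → let open Cut c in ∀ {z} → z ∈ S₂ → z ∈ S₁
        cut-∈ (cut {P₁} {S₁} {P₂} {S₂} {c} refl refl P₁↭P₂ _) {z} z∈ with ∈-split⁻ P₁ z∈ps z≢c
          where
          z∈ps : z ∈ ps
          z∈ps = ∈-resp-↭ (↭-sym ps↭qs) (∈-++⁺ʳ P₂ (there z∈))
          z≢c : z ≢ c
          z≢c = ≢-split P₂ qs! (∈-++⁺ʳ P₂ z∈)
        ... | inj₂ z∈S₁ = z∈S₁
        ... | inj₁ z∈P₁ with ∈-∃++ z∈
        ... | U , V , refl = ⊥-elim (≢-split (P₂ ++ c ∷ U) (subst Unique (sym (++-assoc P₂ _ _)) qs!)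
                (∈-++⁺ˡ (∈-++⁺ˡ (∈-resp-↭ P₁↭P₂ z∈P₁))) refl)

        cut-∈′ : ∀ {b} (c : Cut ps qs b) → let open Cut c in ∀ {z} → z ∈ S₁ → z ∈ S₂
        cut-∈′ (cut {P₁} {S₁} {P₂} {S₂} {c} refl refl P₁↭P₂ _) {z} z∈ with ∈-split⁻ P₂ z∈qs z≢c
          where
          z∈qs : z ∈ qs
          z∈qs = ∈-resp-↭ ps↭qs (∈-++⁺ʳ P₁ (there z∈))
          z≢c : z ≢ c
          z≢c = ≢-split P₁ ps! (∈-++⁺ʳ P₁ z∈)
        ... | inj₂ z∈S₂ = z∈S₂
        ... | inj₁ z∈P₂ with ∈-∃++ z∈
        ... | U , V , refl = ⊥-elim (≢-split (P₁ ++ c ∷ U) (subst Unique (sym (++-assoc P₁ _ _)) ps!)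
                (∈-++⁺ˡ (∈-++⁺ˡ (∈-resp-↭ (↭-sym P₁↭P₂) z∈P₂))) refl)

        -- Let `s` and `k` be the successors of `c` in `ps` and `qs`. If they coincide, the cut
        -- moves on by one position. Otherwise `c` and `s` are both good and linked to `k`, and
        -- their chords are nested with a common right end.
        cut-up : ∀ {b} → 3 + b < length ps → Cut ps qs b → Movable (suc b)
        cut-up _ (cut {[]} _ _ _ ())
        cut-up b< (cut {p ∷ P₁} {[]} refl refl _ sz) = ⊥-elim (<-irrefl refl (≤-trans (<⇒≤ b<)
          (≤-reflexive (trans (length-++ (p ∷ P₁)) (trans (+-comm _ 1) (cong suc sz))))))
        cut-up _ (cut {p ∷ P₁} {s ∷ S₁} {P₂} {[]} {c} refl refl P₁↭P₂ sz)
          with () ← cut-∈′ (cut {S₁ = s ∷ S₁} refl refl P₁↭P₂ sz) (here refl)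
        cut-up _ cu@(cut {U@(p ∷ P₁)} {s ∷ S₁} {P₂} {k ∷ S₂} {c} refl refl P₁↭P₂ sz) with cut-∈ cu (here refl)
        ... | here refl = inj₂ (cut (sym (++-assoc U _ _)) (sym (++-assoc P₂ _ _)) (++⁺ʳ [ c ] P₁↭P₂)
                                 (trans (length-++ U) (trans (+-comm _ 1) (cong suc sz))))
        ... | there k∈ with ∈-∃++ k∈
        ... | γ , β , refl = inj₁ (subst Swap sz (nested-left rot (subst (λ a → Rot a (length γ)) (trans (length-++ U) (+-comm _ 1)) rot′)))
          where
          s∈ : s ∈ S₂
          s∈ with cut-∈′ cu (here refl)
          ... | there s∈   = s∈
          ... | here refl = ⊥-elim (≢-split (U ++ c ∷ s ∷ γ) (subst Unique (sym (++-assoc U _ _)) ps!)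
                              (∈-++⁺ˡ (∈-++⁺ʳ U (there (here refl)))) refl)
          P₂≡ : P₂ ++ c ∷ k ∷ S₂ ≡ (P₂ ∷ʳ c) ++ k ∷ S₂
          P₂≡ = sym (++-assoc P₂ _ _)
          rot : Rot (length U) (suc (length γ))
          rot = link-rot U (s ∷ γ) refl
                  (inj₁ (p , (U , _ , refl , here refl) , (P₂ , _ , refl , ∈-resp-↭ P₁↭P₂ (here refl))))
                  (adjacent⇒Link P₂)
          rot′ : Rot (length (U ∷ʳ c)) (length γ)
          rot′ = link-rot (U ∷ʳ c) γ (sym (++-assoc U _ _))
                   (inj₁ (c , (U ∷ʳ c , _ , sym (++-assoc U _ _) , ∈-++⁺ʳ U (here refl)) , Before-∈ʳ P₂ (there s∈)))
                   (Before⇒Link (subst (λ qs → Before qs k s) (sym P₂≡) (Before-∈ʳ (P₂ ∷ʳ c) s∈)))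

        -- Let `p` and `k` be the predecessors of `c` in `ps` and `qs`. If they differ, `k` starts
        -- one chord to `p`, which precedes it in `qs`, and one to `c`, which follows it there;
        -- these are nested with a common left end.
        cut-down : ∀ {b} → Cut ps qs (suc b) → Movable b
        cut-down {b} (cut {P₁} {S₁} {P₂} {S₂} {c} refl refl P₁↭P₂ sz) with initLast P₁ | initLast P₂
        ... | [] | _ with () ← sz
        cut-down {b} (cut {P₁} {S₁} {P₂} {S₂} {c} refl refl P₁↭P₂ sz) | Q ∷ʳ′ p | []
          with () ← trans (sym (↭-length P₁↭P₂)) (trans (length-++ Q) (+-comm _ 1))
        cut-down {b} (cut {P₁} {S₁} {P₂} {S₂} {c} refl refl P₁↭P₂ sz) | Q ∷ʳ′ p | P₀ ∷ʳ′ k with p ≟ k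
        ... | yes refl = inj₂ (cut (++-assoc Q _ _) (++-assoc P₀ _ _)
                (subst₂ _↭_ (++-identityʳ Q) (++-identityʳ P₀) (drop-mid Q P₀ P₁↭P₂))
                (suc-injective (trans (+-comm 1 _) (trans (sym (length-++ Q)) sz))))
        ... | no p≢k with ∈-split⁻ Q (∈-resp-↭ (↭-sym P₁↭P₂) (∈-++⁺ʳ P₀ (here refl))) (p≢k ∘ sym)
        ... | inj₁ k∈ with ∈-∃++ k∈
        ... | α , γ , refl = inj₁ (subst Swap size′ (nested-right rot (subst (Rot (length α)) (trans (length-++ γ) (+-comm _ 1)) rot′)))
          where
          ps≡ : ps ≡ α ++ k ∷ γ ++ p ∷ c ∷ S₁
          ps≡ = trans (++-assoc (α ++ k ∷ γ) _ _) (++-assoc α _ _)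
          qs≡ : qs ≡ P₀ ++ k ∷ c ∷ S₂
          qs≡ = ++-assoc P₀ _ _
          size′ : length α + length γ ≡ b
          size′ = suc-injective (suc-injective (trans (cong suc (sym (+-suc (length α) _)))
            (trans (cong suc (sym (length-++ α))) (trans (+-comm 1 _) (trans (sym (length-++ (α ++ k ∷ γ))) sz)))))
          before : ∀ {z} → z ∈ (α ++ k ∷ γ) ∷ʳ p → z ≢ k → Before qs z k
          before z∈ z≢ with ∈-split⁻ P₀ (∈-resp-↭ P₁↭P₂ z∈) z≢
          ... | inj₁ z∈P₀ = P₀ , _ , qs≡ , z∈P₀
          p≢ : ∀ {z} → z ∈ α ++ γ ++ p ∷ c ∷ S₁ → z ≢ k
          p≢ = ≢-split α (subst Unique ps≡ ps!)
          good : ∀ α γ → ps ≡ α ++ k ∷ γ ++ p ∷ c ∷ S₁ → (∀ {z} → z ∈ (α ++ k ∷ γ) ∷ʳ p → z ≢ k → Before qs z k) →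
                 (∀ {z} → z ∈ α ++ γ ++ p ∷ c ∷ S₁ → z ≢ k) → Good ps qs k
          good (h ∷ α) γ       eq before ≢k = inj₁ (h , (h ∷ α , _ , eq , here refl) , before (here refl) (≢k (here refl)))
          good []      []      eq before ≢k = inj₂ ([] , p , _ , eq , Before⇒Link (before (there (here refl)) (≢k (here refl))))
          good []      (h ∷ γ) eq before ≢k = inj₂ ([] , h , _ , eq , Before⇒Link (before (there (here refl)) (≢k (here refl))))
          rot : Rot (length α) (length γ)
          rot = link-rot α γ ps≡ (good α γ ps≡ before p≢)
                  (Before⇒Link (before (∈-++⁺ʳ (α ++ k ∷ γ) (here refl)) p≢k))
          rot′ : Rot (length α) (length (γ ∷ʳ p))
          rot′ = link-rot α (γ ∷ʳ p) (trans ps≡ (cong (λ X → α ++ k ∷ X) (sym (++-assoc γ _ _))))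
                   (good α γ ps≡ before p≢) (subst (λ qs → Link qs k c) (sym qs≡) (adjacent⇒Link P₀))

      -- When the covering chord yields only 3-cycles, one of them is combined with the swap at `b`:
      -- it starts at `b`, or at `suc b` if the chord itself begins there.
      Movable-suc : ∀ b → 3 + b < length ps → Movable b → Movable (suc b)
      Movable-suc b b< (inj₂ found) = cut-up b< found
      Movable-suc b b< (inj₁ sw) with cut-or-covering (suc b) (s≤s z≤n) b< ps! ps↭qs
      ... | inj₁ found = inj₂ found
      ... | inj₂ cov with chord-moves (Covering.chord cov)
      ...   | inj₁ all with offset (Covering.left cov) (Covering.right cov)
      ...     | t , eq , t< = inj₁ (subst Swap eq (all t t<))
      Movable-suc b b< (inj₁ sw) | inj₂ cov | inj₂ (2≤m , cycles) with m≤n⇒m<n∨m≡n (Covering.left cov)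
      ... | inj₁ (s≤s a≤b) with offset′ a≤b (Covering.right cov)
      ...   | t , eq , t< = inj₁ (Swap-suc sw (subst Cycle₃ eq (cycles t t<)))
      Movable-suc b b< (inj₁ sw) | inj₂ cov | inj₂ (2≤m , cycles) | inj₂ eq =
        inj₁ (Swap-suc′ (≤-trans (≤-reflexive (+-suc b 3)) (≤-trans (+-monoʳ-≤ (suc b) (s≤s 2≤m))
                (subst (λ a → a + suc (length (Covering.γ cov)) ≤ r) eq (proj₁ (chord-rot (Covering.chord cov))))))
              sw (subst Cycle₃ (trans (+-identityʳ _) eq) (cycles 0 2≤m)))

      -- Here the swap is at `suc b`. A 3-cycle starts at `b` unless the rotated block ends right
      -- behind the gap; then the last 3-cycle of the block starts one place before `b`.
      Movable-pred : ∀ b → 1 ≤ b → 3 + b < length ps → Movable (suc b) → Movable b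
      Movable-pred b 1≤b b< (inj₂ found) = cut-down found
      Movable-pred b 1≤b b< (inj₁ sw) with cut-or-covering b 1≤b (<⇒≤ b<) ps! ps↭qs
      ... | inj₁ found = inj₂ found
      ... | inj₂ cov with chord-moves (Covering.chord cov)
      ...   | inj₁ all with offset (Covering.left cov) (Covering.right cov)
      ...     | t , eq , t< = inj₁ (subst Swap eq (all t t<))
      Movable-pred b 1≤b b< (inj₁ sw) | inj₂ cov | inj₂ (2≤m , cycles) with m≤n⇒m<n∨m≡n (Covering.right cov)
      ... | inj₁ right with offset′ (Covering.left cov) right
      ...   | t , eq , t< = inj₁ (Swap-pred
          (≤-trans (≤-reflexive (+-comm b 3)) (s≤s⁻¹ (subst (4 + b ≤_) size b<))) sw (subst Cycle₃ eq (cycles t t<)))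
      Movable-pred (suc b) 1≤b b< (inj₁ sw) | inj₂ cov | inj₂ (2≤m , cycles) | inj₂ eq = inj₁ (Swap-pred′
          (≤-trans (≤-reflexive (+-comm b 4)) (s≤s⁻¹ (subst (5 + b ≤_) size b<))) sw (last _ 2≤m eq cycles))
        where
        a = length (Covering.α cov)
        last : ∀ m → 2 ≤ m → 2 + b ≡ a + m → (∀ t → suc t < m → Cycle₃ (a + t)) → Cycle₃ b
        last (suc zero) (s≤s ())
        last (suc (suc m)) _ eq cycles = subst Cycle₃
          (suc-injective (suc-injective (trans (cong suc (sym (+-suc a m))) (trans (sym (+-suc a (suc m))) (sym eq)))))
          (cycles m ≤-refl)

      seed⇒Movable : Seed ps qs → ∀ b → 1 ≤ b → 2 + b < length ps → Movable b
      seed⇒Movable (X , i , j , k , Y , split , good , link) b 1≤b b< with ≤-total s b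
        where s = length X
      ... | inj₁ s≤b with m≤n⇒∃[o]m+o≡n s≤b
      ...   | d , refl = up d b<
        where
        s = length X
        up : ∀ d → 2 + (s + d) < length ps → Movable (s + d)
        up zero    _  = inj₁ (+0 Swap (Rot₁⇒Swap (link-rot X [ j ] split good link)))
        up (suc d) lt = subst Movable (sym (+-suc s d))
          (Movable-suc (s + d) lt′ (up d (<⇒≤ lt′)))
          where lt′ = subst (λ t → 2 + t < length ps) (+-suc s d) lt
      seed⇒Movable (X , i , j , k , Y , split , good , link) b 1≤b b< | inj₂ b≤s with m≤n⇒∃[o]m+o≡n b≤s
      ... | d , eq = down d b eq 1≤b
        where
        s = length X
        s< : 2 + s < length ps
        s< = subst (2 + s <_) (sym (trans (cong length split) (trans (length-++ X) (+-comm s _)))) (s≤s (s≤s (s≤s (m≤n+m s _))))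
        down : ∀ d b → b + d ≡ s → 1 ≤ b → Movable b
        down zero    b eq _ = inj₁ (subst Swap (trans (sym eq) (+-identityʳ b)) (Rot₁⇒Swap (link-rot X [ j ] split good link)))
        down (suc d) b eq 1≤b = Movable-pred b 1≤b
          (≤-trans (s≤s (s≤s (s≤s (≤-trans (s≤s (m≤m+n b d)) (≤-reflexive (trans (sym (+-suc b d)) eq)))))) s<)
          (down d (suc b) (trans (sym (+-suc b d)) eq) (s≤s z≤n))

      -- From moves on words to the equality of F and G

      private
        -- Letters can be assigned so that `w` is the reading along `i ∷ T`. The moves turn the
        -- reading along `i ∷ S` into it under `F`, and `conn′` links that reading to `G w`.
        connected-eq : ∀ {i S T} → Connects (i ∷ S) (i ∷ T) → S ↭ T → Unique (i ∷ S) → suc (length S) ≡ r →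
                       (∀ (u : P → A) → u i ∷ map u S ~ u i ∷ map u T) → ∀ w → Valid w → F w ≡ G w
        connected-eq _ _ _ () _ [] (_ , refl)
        connected-eq {i} {S} {T} conn′ S↭T S! lS moves w@(x ∷ _) valid@(w! , lw) = begin
          F w                            ≡⟨ cong F (sym mT) ⟩
          F (u i ∷ map u T)              ≡⟨ sym (eq (moves u) validS) ⟩
          F (u i ∷ map u S)              ≡⟨ cong F (sym (dedup-unique (proj₁ validS))) ⟩
          F (dedup (map u (i ∷ S)))      ≡⟨ conn′ u ⟩
          G (dedup (map u (i ∷ T)))      ≡⟨ cong G (trans (cong dedup mT) (dedup-unique w!)) ⟩
          G w                            ∎
          where
          open ≡-Reasoning
          u = assign (i ∷ T) x w
          iS↭iT : i ∷ S ↭ i ∷ T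
          iS↭iT = ++⁺ˡ [ i ] S↭T
          mT : map u (i ∷ T) ≡ w
          mT = map-assign (i ∷ T) x w (Unique-resp-↭ iS↭iT S!) (trans lw (trans (sym lS) (↭-length iS↭iT)))
          validS : Valid (map u (i ∷ S))
          validS = Valid-resp-↭ (map⁺ u (↭-sym iS↭iT)) (subst Valid (sym mT) valid)

        ∈-take⁺ : ∀ (X : List P) {Y n z} → length X ≤ n → z ∈ X → z ∈ take n (X ++ Y)
        ∈-take⁺ (x ∷ X) (s≤s X≤) (here eq)  = here eq
        ∈-take⁺ (x ∷ X) (s≤s X≤) (there z∈) = there (∈-take⁺ X X≤ z∈)

        ∈-take-insert : ∀ (X : List P) {Y n y z} → z ∈ take n (X ++ Y) → z ∈ take (suc n) (X ++ y ∷ Y)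
        ∈-take-insert []      {n = suc n} z∈         = there z∈
        ∈-take-insert (x ∷ X) {n = suc n} (here eq)  = here eq
        ∈-take-insert (x ∷ X) {n = suc n} (there z∈) = there (∈-take-insert X z∈)

        -- The common letter of `i` leaves the gaps `suc t` to `sort`. At a cut there, the first
        -- `3 + t` positions of `ps` and `qs` form the same set; without `i` and `j` this set
        -- consists of the first `suc t` elements of `X ++ Y`, provided that `j` lies in it, which
        -- the disjunction ensures.
        seed-eq : ∀ {i j} X Y {T} → ps ≡ i ∷ X ++ j ∷ Y → Seed ps qs → Connects (i ∷ X ++ Y) (i ∷ T) → X ++ Y ↭ T →
                  (∀ n {z} → z ∈ take n T → z ∈ take (2 + n) qs) →
                  X ≡ [] ⊎ (∀ {b} (c : Cut ps qs b) → j ∈ Cut.P₁ c) →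
                  ∀ w → Valid w → F w ≡ G w
        seed-eq {i} {j} X Y {T} refl seed conn′ S↭T T⊆ early = connected-eq conn′ S↭T S! size′ moves
          where
          jS! : Unique (j ∷ i ∷ X ++ Y)
          jS! = Unique-resp-↭ (shift j (i ∷ X) Y) ps!
          S! : Unique (i ∷ X ++ Y)
          S! = tail jS!
          size″ : length ps ≡ 2 + length (X ++ Y)
          size″ = ↭-length (shift j (i ∷ X) Y)
          size′ : suc (length (X ++ Y)) ≡ r
          size′ = suc-injective (trans (sym size″) size)
          moves : ∀ (u : P → A) → u i ∷ map u (X ++ Y) ~ u i ∷ map u T
          moves u = assuming-valid (++⁺ˡ [ u i ] (map⁺ u S↭T)) λ valid → sort [ u i ] (map⁺ u S↭T) (tail (proj₁ valid)) gap
            where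
            gap : ∀ t → suc t < length (map u (X ++ Y)) → Swap (suc t) ⊎
                  (∀ {y} → y ∈ take (suc t) (map u T) → y ∈ take (suc t) (map u (X ++ Y)))
            gap t t< with seed⇒Movable seed (suc t) (s≤s z≤n)
                            (subst (3 + t <_) (sym size″) (s≤s (s≤s (subst (suc t <_) (length-map u (X ++ Y)) t<))))
            ... | inj₁ sw = inj₁ sw
            ... | inj₂ found@(cut {P₁} {S₁} {P₂} {S₂} {c} ps≡ qs≡ P₁↭P₂ sz) = inj₂ λ y∈ →
                let z , z∈ , y≡ = ∈-map⁻ u (subst (_ ∈_) (take-map (suc t) T) y∈) in
                subst (_ ∈_) (sym (take-map (suc t) (X ++ Y))) (subst (_∈ map u (take (suc t) (X ++ Y))) (sym y≡) (∈-map⁺ u (first z∈)))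
              where
              len : ∀ U → length U ≡ 2 + t → length (U ∷ʳ c) ≡ 3 + t
              len U lU = trans (length-++ U) (trans (+-comm _ 1) (cong suc lU))
              into-ps : ∀ {z} → z ∈ P₁ ∷ʳ c → z ∈ take (3 + t) (i ∷ X ++ j ∷ Y)
              into-ps z∈ = subst (λ ps → _ ∈ take (3 + t) ps) (trans (++-assoc P₁ _ _) (sym ps≡))
                (∈-take⁺ (P₁ ∷ʳ c) (≤-reflexive (len P₁ sz)) z∈)
              behind-i : ∀ {z} → z ∈ take (3 + t) (i ∷ X ++ j ∷ Y) → z ≢ i → z ∈ take (2 + t) (X ++ j ∷ Y)
              behind-i (here eq)  z≢i = ⊥-elim (z≢i eq)
              behind-i (there z∈) _   = z∈
              X≤ : length X ≤ suc t
              X≤ = short early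
                where
                short : X ≡ [] ⊎ (∀ {b} (c : Cut ps qs b) → j ∈ Cut.P₁ c) → length X ≤ suc t
                short (inj₁ refl) = z≤n
                short (inj₂ early) = ≤-pred (≰⇒> λ le → Unique[x∷xs]⇒x∉xs jS! (there (∈-++⁺ˡ (∈-take-++ X le
                  (behind-i (into-ps (∈-++⁺ˡ (early found))) λ j≡i → Unique[x∷xs]⇒x∉xs jS! (here j≡i))))))
              first : ∀ {z} → z ∈ take (suc t) T → z ∈ take (suc t) (X ++ Y)
              first z∈ = ∈-take-delete X X≤ (λ { refl → Unique[x∷xs]⇒x∉xs jS! (there z∈S) })
                (behind-i (into-ps (∈-resp-↭ (++⁺ʳ [ c ] (↭-sym P₁↭P₂))
                  (∈-take-++ (P₂ ∷ʳ c) (≤-reflexive (sym (len P₂ (trans (sym (↭-length P₁↭P₂)) sz))))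
                    (subst (λ qs → _ ∈ take (3 + t) qs) (trans qs≡ (sym (++-assoc P₂ _ _))) (T⊆ (suc t) z∈)))))
                  (λ { refl → Unique[x∷xs]⇒x∉xs S! z∈S }))
                where
                z∈S = ∈-resp-↭ (↭-sym S↭T) (∈-take (suc t) z∈)

        by-seed : Seed ps qs → ∀ w → Valid w → F w ≡ G w
        by-seed seed@(X₀ , _ , _ , _ , _ , split , _) = go seed (heads 2≤ ps↭qs) refl refl
          where
          2≤ : 2 ≤ length ps
          2≤ = subst (2 ≤_) (sym (trans (cong length split) (length-++ X₀))) (≤-trans (s≤s (s≤s z≤n)) (m≤n+m _ (length X₀)))
          go : ∀ {xs ys} → Seed xs ys → Heads xs ys → ps ≡ xs → qs ≡ ys → ∀ w → Valid w → F w ≡ G w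
          go seed (same i j Y Z W) refl refl = seed-eq [] Y refl seed
            (drop-repeat [ i ] Y (i ∷ Z) W refl refl (here refl) (here refl) ps! qs! conn)
            (drop-mid [] Z (drop-∷ ps↭qs)) (λ n z∈ → there (∈-take-insert Z z∈)) (inj₁ refl)
          go seed (differ i h X Y Z W i≢h) refl refl = seed-eq X Y refl seed
            (merge-heads X Y Z W ps! qs! conn)
            (drop-mid [] Z (drop-mid (i ∷ X) [] ps↭qs)) (λ n z∈ → there (∈-take-insert Z z∈)) (inj₂ first-cut)
            where
            -- As the first position of `qs`, `h` lies in front of every cut.
            first-cut : ∀ {b} (c : Cut ps qs b) → h ∈ Cut.P₁ c
            first-cut (cut {P₂ = []}     _ _    p sz) with () ← trans (sym sz) (↭-length p)
            first-cut (cut {P₂ = _ ∷ _} _ eq p sz) = ∈-resp-↭ (↭-sym p) (here (proj₁ (∷-injective eq)))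

        -- For `i j k l` against `j i l k`, the chord from `i` to `l` jumps over `j` and `k`: `l`
        -- directly follows `i` in the second order, and `i` is good because its neighbour `j`
        -- precedes it there.
        pairs-cycles : ∀ U V {xs ys} → Pairs xs ys → ps ≡ U ++ xs → qs ≡ V ++ ys →
                       ∀ s → 4 + s * 2 ≤ length xs → Cycle₃ (length U + s * 2)
        pairs-cycles U V (pair i j (pair k l p)) refl refl zero _ =
          +0 Cycle₃ (Rot₂⇒Cycle₃ (link-rot U (j ∷ k ∷ []) refl
            (inj₂ (U , j , _ , refl , Before⇒Link (V ++ [ j ] , _ , V≡ , ∈-++⁺ʳ V (here refl))))
            (V ++ [ j ] , _ , V≡ , inj₂ (_ , refl))))
          where
          V≡ : ∀ {Z} → V ++ j ∷ Z ≡ (V ++ [ j ]) ++ Z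
          V≡ = sym (++-assoc V _ _)
        pairs-cycles U V (pair i j p) refl refl (suc s) (s≤s (s≤s le)) =
          subst Cycle₃ (trans (cong (_+ s * 2) (length-++ U)) (+-assoc (length U) 2 _))
            (pairs-cycles (U ++ i ∷ j ∷ []) (V ++ j ∷ i ∷ []) p (sym (++-assoc U _ _)) (sym (++-assoc V _ _)) s le)
        pairs-cycles U V (pair i j []) _ _ zero (s≤s (s≤s ()))

        -- Each `double-swap` needs a letter in front of its two pairs. This is `x` for the first
        -- four letters and the last exchanged letter for the next four.
        quads : ∀ q X x (u : P → A) {xs ys} → Pairs xs ys → length xs ≡ q * 4 →
                (∀ s → s < q * 2 → Cycle₃ (length X + s * 2)) → X ++ x ∷ map u xs ~ X ++ x ∷ map u ys
        quads zero    X x u []            _  _      = ~-refl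
        quads (suc q) X x u (pair i j (pair {xs} {ys} k l p)) eq cycles =
          X ++ x ∷ u i ∷ u j ∷ u k ∷ u l ∷ map u xs
            ~⟨ double-swap (subst Cycle₃ (+-identityʳ _) (cycles 0 (s≤s z≤n))) (subst Cycle₃ (+-comm _ 2) (cycles 1 (s≤s (s≤s z≤n))))
                 x (u i) (u j) (u k) (u l) X (map u xs) refl ⟩
          X ++ x ∷ u j ∷ u i ∷ u l ∷ u k ∷ map u xs
            ≈⟨ sym (++-assoc X (x ∷ u j ∷ u i ∷ u l ∷ []) _) ⟩
          (X ++ x ∷ u j ∷ u i ∷ u l ∷ []) ++ u k ∷ map u xs
            ~⟨ quads q (X ++ x ∷ u j ∷ u i ∷ u l ∷ []) (u k) u p (suc-injective (suc-injective (suc-injective (suc-injective eq))))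
                 (λ s s< → subst Cycle₃ (sym (trans (cong (_+ s * 2) (length-++ X)) (+-assoc (length X) 4 _)))
                   (cycles (2 + s) (s≤s (s≤s s<)))) ⟩
          (X ++ x ∷ u j ∷ u i ∷ u l ∷ []) ++ u k ∷ map u ys
            ≈⟨ ++-assoc X (x ∷ u j ∷ u i ∷ u l ∷ []) _ ⟩
          X ++ x ∷ u j ∷ u i ∷ u l ∷ u k ∷ map u ys ∎
          where open ~-Reasoning

        quad-room : ∀ s q {n} → s < q * 2 → n ≡ 2 + q * 4 → 4 + s * 2 ≤ n
        quad-room s q s< refl = s≤s (s≤s (≤-trans (*-monoˡ-≤ 2 s<) (≤-reflexive (*-assoc q 2 2))))

        by-rigid : Rigid ps qs → 1 ≤ r → (∀ w → Valid w → F w ≡ G w) ⊎ Exceptional ps qs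
        by-rigid rigid 1≤r = go rigid refl refl
          where
          identical : ∀ xs → ps ≡ xs → qs ≡ xs → ∀ w → Valid w → F w ≡ G w
          identical [] refl refl = ⊥-elim (1+n≢0 (sym size))
          identical (i ∷ []) refl refl = ⊥-elim (<-irrefl (suc-injective size) 1≤r)
          identical (i ∷ j ∷ Y) refl refl = connected-eq
            (drop-repeat [ i ] Y [ i ] Y refl refl (here refl) (here refl) ps! qs! conn)
            ↭-refl (tail (Unique-resp-↭ (shift j [ i ] Y) ps!)) (suc-injective size) (λ _ → ~-refl)
          go : ∀ {xs ys} → Rigid xs ys → ps ≡ xs → qs ≡ ys → (∀ w → Valid w → F w ≡ G w) ⊎ Exceptional ps qs
          go same e e′ = inj₁ (identical _ e e′)
          go (pairs p) refl refl with Pairs-length p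
          ... | q , inj₁ len = inj₂ (pairs q p len)
          -- The hole takes one position of the first pair. The other one provides the letter in
          -- front for `quads`, and an even number of pairs remains.
          go (pairs p@(pair {Y} {Y′} i j p′)) refl refl | q , inj₂ len = inj₁ (connected-eq
            (merge-heads [] Y [] Y′ ps! qs! conn) (drop-∷ (drop-mid [ i ] [] ps↭qs))
            (tail (Unique-resp-↭ (shift j [ i ] Y) ps!)) (suc-injective size)
            (λ u → quads q [] (u i) u p′ (suc-injective (suc-injective len))
              λ s s< → pairs-cycles [] [] p refl refl s (quad-room s q s< len)))
          go (one+pairs h p) refl refl with Pairs-length p
          ... | q , inj₁ len = inj₂ (one+pairs q h p len)
          go (one+pairs h p@(pair {Y} {Y′} i j p′)) refl refl | q , inj₂ len = inj₁ (connected-eq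
            (drop-repeat [ h ] (j ∷ Y) (h ∷ j ∷ []) Y′ refl refl (here refl) (here refl) ps! qs! conn)
            (drop-mid [] [ j ] (drop-∷ ps↭qs))
            (tail (Unique-resp-↭ (shift i [ h ] (j ∷ Y)) ps!)) (suc-injective size)
            (λ u → quads q [ u h ] (u j) u p′ (suc-injective (suc-injective len))
              λ s s< → pairs-cycles [ h ] [ h ] p refl refl s (quad-room s q s< len)))

      one-repeat : 1 ≤ r → (∀ w → Valid w → F w ≡ G w) ⊎ Exceptional ps qs
      one-repeat 1≤r with seed-or-rigid (length ps) ≤-refl ps↭qs ps!
      ... | inj₁ seed  = inj₁ (by-seed seed)
      ... | inj₂ rigid = by-rigid rigid 1≤r

    -- Two or more repetitions

    Agree : ℕ → Set _
    Agree r = ∀ w → Unique w → length w ≡ r → F w ≡ G w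

    agree-or-exceptional : ∀ {ps qs r} → ps ↭ qs → Unique ps → Connects ps qs → length ps ≡ suc r → 1 ≤ r →
                           Agree r ⊎ Exceptional ps qs
    agree-or-exceptional ps↭qs ps! conn size 1≤r with Puzzle.one-repeat ps↭qs ps! conn size 1≤r
    ... | inj₁ agree = inj₁ λ w w! lw → agree w (w! , lw)
    ... | inj₂ exc   = inj₂ exc

    private
      4∤1+4* : ∀ p q → suc (p * 4) ≢ q * 4
      4∤1+4* zero    zero    ()
      4∤1+4* zero    (suc q) ()
      4∤1+4* (suc p) (suc q) eq =
        4∤1+4* p q (suc-injective (suc-injective (suc-injective (suc-injective eq))))

      same-pairs : ∀ {i X Y} → Unique (i ∷ X) → ¬ Pairs (i ∷ X) (i ∷ Y)
      same-pairs i! (pair _ _ _) = Unique[x∷xs]⇒x∉xs i! (here refl)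

      shorter : ∀ {n} X (i : P) Y → length (X ++ i ∷ Y) ≡ suc n → length (X ++ Y) ≡ n
      shorter X i Y eq = suc-injective (trans (sym (↭-length (shift i X Y))) eq)

      unique-delete : ∀ X {i : P} {Y} → Unique (X ++ i ∷ Y) → Unique (X ++ Y)
      unique-delete X {i} {Y} X! = tail (Unique-resp-↭ (shift i X Y) X!)

      exceptional-heads : ∀ {i j X Y q} → Exceptional (i ∷ X) (j ∷ Y) → length (i ∷ X) ≡ suc (q * 4) → i ≡ j
      exceptional-heads {q = q} (pairs p _ eq) len = ⊥-elim (4∤1+4* q p (trans (sym len) eq))
      exceptional-heads (one+pairs _ _ _ _) _ = refl

      head-≡ : ∀ {h i X} A {B : List P} {k} → i ∷ X ≡ A ++ k ∷ B → h ∈ A → ∃ λ A₀ → A ≡ i ∷ A₀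
      head-≡ (_ ∷ A) eq _ = A , cong (_∷ A) (sym (proj₁ (∷-injective eq)))

      common-order : ∀ {q S T} → Pairs S T → length S ≡ suc q * 4 → ∃₂ λ i j → Before S i j × Before T i j
      common-order (pair i j (pair k l p)) _ =
        i , k , Before-∈ʳ [] (there (here refl)) , Before-∈ʳ [ j ] (there (here refl))

      second-pair : ∀ {i j k l X Y} → Pairs (i ∷ j ∷ k ∷ l ∷ X) Y → Before Y j k
      second-pair (pair _ _ (pair _ _ _)) = Before-∈ʳ [] (there (there (here refl)))

      -- Without `j`, the orders exchange `k` with `l` and `m` with `n`. Now `m` is discarded
      -- instead. If the result were exceptional too, it would pair `j` with `k` and `l` with `n`,
      -- so `k` would precede `l` in the second order, contrary to the exchange of `k` and `l`.
      same-case : ∀ {i j Y Q T q r} → i ∷ j ∷ Y ↭ i ∷ Q → Unique (i ∷ j ∷ Y) → Connects (i ∷ j ∷ Y) (i ∷ Q) →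
                  length (i ∷ j ∷ Y) ≡ 2 + r → 1 ≤ r → Pairs Y T → length Y ≡ suc q * 4 →
                  (∀ {k l} → Before T k l → Before Q k l) → Agree r
      same-case {i} {j} p ps! conn size 1≤r (pair k l (pair {Y} m n ps)) _ T⊆Q
        with ∈-∃++ (∈-resp-↭ (drop-∷ p) (there (there (there (here refl)))))
      ... | U , V , refl with agree-or-exceptional (drop-mid (i ∷ j ∷ k ∷ l ∷ []) (i ∷ U) p)
                               (unique-delete (i ∷ j ∷ k ∷ l ∷ []) ps!)
                               (drop-repeat (i ∷ j ∷ k ∷ l ∷ []) (n ∷ Y) (i ∷ U) V refl refl (here refl) (here refl)
                                 ps! (Unique-resp-↭ p ps!) conn)
                               (shorter (i ∷ j ∷ k ∷ l ∷ []) m (n ∷ Y) size) 1≤r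
      ... | inj₁ agree = agree
      ... | inj₂ (pairs _ p′ _) = ⊥-elim (same-pairs (unique-delete (i ∷ j ∷ k ∷ l ∷ []) ps!) p′)
      ... | inj₂ (one+pairs _ _ p′ _) = ⊥-elim (Before-asym (tail (Unique-resp-↭ p ps!))
              (Before-insert U (second-pair p′)) (T⊆Q (Before-∈ʳ [] (here refl))))

    -- A position can be discarded by repeating there a letter that occurs earlier in both readings.
    -- If what remains is exceptional, then another choice of the discarded position is not.
    two-repeats : ∀ {ps qs r} → ps ↭ qs → Unique ps → Connects ps qs → length ps ≡ 2 + r → 1 ≤ r → Agree r
    two-repeats {ps} {qs} {r} ps↭qs ps! conn size 1≤r
      with heads (subst (2 ≤_) (sym size) (s≤s (s≤s z≤n))) ps↭qs
    ... | same i j Y Z W = go (agree-or-exceptional (drop-mid [ i ] (i ∷ Z) ps↭qs) (unique-delete [ i ] ps!)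
            (drop-repeat [ i ] Y (i ∷ Z) W refl refl (here refl) (here refl) ps! (Unique-resp-↭ ps↭qs ps!) conn)
            (shorter [ i ] j Y size) 1≤r) (λ before → Before-insert Z before)
      where
      go : ∀ {T} → Agree r ⊎ Exceptional (i ∷ Y) (i ∷ T) → (∀ {k l} → Before T k l → Before (Z ++ j ∷ W) k l) → Agree r
      go (inj₁ agree) _ = agree
      go (inj₂ (pairs _ p _)) _ = ⊥-elim (same-pairs (unique-delete [ i ] ps!) p)
      go (inj₂ (one+pairs zero _ _ eq)) _ = ⊥-elim (<-irrefl (trans (sym eq) (suc-injective (shorter [ i ] j Y size))) 1≤r)
      go (inj₂ (one+pairs (suc q) _ p eq)) T⊆ = same-case {q = q} ps↭qs ps! conn size 1≤r p eq T⊆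
    ... | differ i j X Y Z W i≢j = go (agree-or-exceptional (++⁺ˡ [ i ] (drop-mid [] Z (drop-mid (i ∷ X) [] ps↭qs)))
            (unique-delete (i ∷ X) ps!) (merge-heads X Y Z W ps! (Unique-resp-↭ ps↭qs ps!) conn) (shorter (i ∷ X) j Y size) 1≤r)
            (unique-delete (i ∷ X) ps!) (suc-injective (shorter (i ∷ X) j Y size))
            (λ before → Before-++⁺ʳ [ i ] (Before-insert X before)) (λ before → Before-++⁺ʳ [ j ] (Before-insert Z before))
      where
      go : ∀ {S T} → Agree r ⊎ Exceptional (i ∷ S) (i ∷ T) → Unique (i ∷ S) → length S ≡ r →
           (∀ {k l} → Before S k l → Before ps k l) → (∀ {k l} → Before T k l → Before qs k l) → Agree r
      go (inj₁ agree) _ _ _ _ = agree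
      go (inj₂ (pairs _ p _)) S! _ _ _ = ⊥-elim (same-pairs S! p)
      go (inj₂ (one+pairs zero _ _ eq)) _ len _ _ = ⊥-elim (<-irrefl (trans (sym eq) len) 1≤r)
      -- Elements `k` and `l` of different pairs have the same order in both lists. Discarding `l`
      -- keeps the different first positions, whereas an exceptional pair of orders whose length is
      -- one more than a multiple of four has a common first position.
      go (inj₂ (one+pairs (suc q) _ p eq)) _ len S⊆ T⊆ with common-order {q} p eq
      ... | k , l , before , before′ with S⊆ before | T⊆ before′
      ... | A , B , ps≡ , k∈ | A′ , B′ , qs≡ , k∈′ with head-≡ A ps≡ k∈ | head-≡ A′ qs≡ k∈′
      ... | A₀ , refl | A₀′ , refl with agree-or-exceptional
              (drop-mid A A′ (subst₂ _↭_ ps≡ qs≡ ps↭qs)) (unique-delete A (subst Unique ps≡ ps!))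
              (drop-repeat A B A′ B′ ps≡ qs≡ k∈ k∈′ ps! (Unique-resp-↭ ps↭qs ps!) conn)
              (shorter A l B (trans (cong length (sym ps≡)) size)) 1≤r
      ... | inj₁ agree = agree
      ... | inj₂ exc = ⊥-elim (i≢j (exceptional-heads {q = suc q} exc
              (trans (shorter A l B (trans (cong length (sym ps≡)) size)) (cong suc (trans (sym len) eq)))))

    more-repeats : ∀ d {ps qs r} → ps ↭ qs → Unique ps → Connects ps qs → length ps ≡ d + (2 + r) → 1 ≤ r → Agree r
    more-repeats zero    p ps! conn size 1≤r = two-repeats p ps! conn size 1≤r
    more-repeats (suc d) {r = r} p ps! conn size 1≤r
      with heads (subst (2 ≤_) (sym size) (≤-trans (s≤s (s≤s z≤n)) (m≤n+m (2 + r) (suc d)))) p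
    ... | same i j Y Z W = more-repeats d (drop-mid [ i ] (i ∷ Z) p) (unique-delete [ i ] ps!)
            (drop-repeat [ i ] Y (i ∷ Z) W refl refl (here refl) (here refl) ps! (Unique-resp-↭ p ps!) conn)
            (shorter [ i ] j Y size) 1≤r
    ... | differ i j X Y Z W i≢j = more-repeats d (++⁺ˡ [ i ] (drop-mid [] Z (drop-mid (i ∷ X) [] p)))
            (unique-delete (i ∷ X) ps!) (merge-heads X Y Z W ps! (Unique-resp-↭ p ps!) conn)
            (shorter (i ∷ X) j Y size) 1≤r

-- Sufficiency of the bounds

unique-⊆⇒length≤ : {v w : List C} → Unique v → (∀ {x} → x ∈ v → x ∈ w) → length v ≤ length w
unique-⊆⇒length≤ {v = []}    _  _  = z≤n
unique-⊆⇒length≤ {v = x ∷ v} v! v⊆ with ∈-∃++ (v⊆ (here refl))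
... | X , Y , refl = ≤-trans (s≤s (unique-⊆⇒length≤ (tail v!) rest)) (≤-reflexive (sym (↭-length (shift x X Y))))
  where
  rest : ∀ {y} → y ∈ v → y ∈ X ++ Y
  rest y∈ with ∈-++⁻ X (v⊆ (there y∈))
  ... | inj₁ y∈X          = ∈-++⁺ˡ y∈X
  ... | inj₂ (there y∈Y)  = ∈-++⁺ʳ X y∈Y
  ... | inj₂ (here refl) = ⊥-elim (Unique[x∷xs]⇒x∉xs v! y∈)

permuted-↭ : ∀ {n} (σ : Permutation′ n) → allFin n ↭ map (σ ⟨$⟩ʳ_) (allFin n)
permuted-↭ {n} σ = ↭-sym (∼bag⇒↭ (unique∧set⇒bag
  (UniqueProperties.map⁺ injective (allFin⁺ n)) (allFin⁺ n) (λ {i} → mk⇔ (λ _ → ∈-allFin i) λ _ →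
    subst (_∈ map (σ ⟨$⟩ʳ_) (allFin n)) (inverseʳ σ) (∈-map⁺ (σ ⟨$⟩ʳ_) (∈-allFin (σ ⟨$⟩ˡ i))))))
  where
  injective : ∀ {i j} → σ ⟨$⟩ʳ i ≡ σ ⟨$⟩ʳ j → i ≡ j
  injective eq = trans (sym (inverseˡ σ)) (trans (cong (σ ⟨$⟩ˡ_) eq) (inverseˡ σ))

toList-tabulate : ∀ {n} (h : Fin n → C) → toList (Vec.tabulate h) ≡ map h (allFin n)
toList-tabulate {n = zero}  h = refl
toList-tabulate {n = suc n} h = cong (h zero ∷_) (trans (toList-tabulate (h ∘ suc))
  (trans (map-tabulate (λ i → i) (h ∘ suc)) (sym (map-tabulate suc h))))

module _ {A : Set} (_≟_ : DecidableEquality A) {B : Set ℓ} where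

  open Dedup _≟_

  tuple-≡ : ∀ {v w : List A} .{p q} .{p′ q′} → v ≡ w → tuple v p q ≡ tuple w p′ q′
  tuple-≡ refl = refl

  -- The puzzle works with functions on all lists. The default `d` is for the empty list, which is
  -- no element of `A ♯`.
  onLists : B → (A ♯ → B) → List A → B
  onLists d f* []      = d
  onLists d f* (x ∷ w) = f* (tuple (dedup (x ∷ w)) (s≤s z≤n) (deduplicate-! _≟_ (x ∷ w)))

  onLists-dedup : ∀ d f* w → onLists d f* (dedup w) ≡ onLists d f* w
  onLists-dedup d f* []      = refl
  onLists-dedup d f* (x ∷ w) = cong f* (tuple-≡ (dedup-unique (deduplicate-! _≟_ (x ∷ w))))

  onLists-toList : ∀ {n} .{{_ : NonZero n}} d f* (u : Vec A n) → onLists d f* (toList u) ≡ f* (ofo _≟_ u)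
  onLists-toList d f* (x ∷ u) = refl

  -- The puzzle is played with the `r ≤ k` letters that occur in `u`. There is a single repetition
  -- only if `r = k` and `n = k + 1`; there the conditions on `suc k` exclude exceptional orders. In
  -- all other cases `n ≥ r + 2`.
  equalizing : ∀ {n k} .{{_ : NonZero n}} → A ↔ Fin k →
               (k + 1 ≤ n × (∀ q → suc k ≢ q * 4) × (∀ q → suc k ≢ suc (q * 4))) ⊎ k + 2 ≤ n →
               (f g : Vec A n → B) → DeterminedByOfo _≟_ f → DeterminedByOfo _≟_ g →
               Equivalent f g → ∀ u → f u ≡ g u
  equalizing {n} {k} |A|=k bound f g (f* , f≡) (g* , g≡) (σ , f≡gσ) u@(x ∷ u′) = begin
    f u           ≡⟨ f≡F u ⟩
    F (toList u)  ≡⟨ sym (onLists-dedup (f u) f* (toList u)) ⟩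
    F w           ≡⟨ agree bound w w! refl ⟩
    G w           ≡⟨ onLists-dedup (f u) g* (toList u) ⟩
    G (toList u)  ≡⟨ sym (g≡G u) ⟩
    g u           ∎
    where
    open ≡-Reasoning
    F G : List A → B
    F = onLists (f u) f*
    G = onLists (f u) g*
    f≡F : ∀ v → f v ≡ F (toList v)
    f≡F v = trans (f≡ v) (sym (onLists-toList (f u) f* v))
    g≡G : ∀ v → g v ≡ G (toList v)
    g≡G v = trans (g≡ v) (sym (onLists-toList (f u) g* v))
    w = dedup (toList u)
    w! = deduplicate-! _≟_ (toList u)
    open Reading _≟_ {Fin n} Fin._≟_
    open Connected F G
    ps qs : List (Fin n)
    ps = allFin n
    qs = map (σ ⟨$⟩ʳ_) ps
    |ps|≡n : length ps ≡ n
    |ps|≡n = length-tabulate (λ i → i)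
    conn : Connects ps qs
    conn h = begin
      F (dedup (map h ps))       ≡⟨ onLists-dedup (f u) f* (map h ps) ⟩
      F (map h ps)               ≡⟨ cong F (sym (toList-tabulate h)) ⟩
      F (toList v)               ≡⟨ sym (f≡F v) ⟩
      f v                        ≡⟨ f≡gσ v ⟩
      g (v · σ)                  ≡⟨ g≡G (v · σ) ⟩
      G (toList (v · σ))         ≡⟨ cong G (trans (toList-tabulate _) (map-cong (λ i → lookup∘tabulate h (σ ⟨$⟩ʳ i)) ps)) ⟩
      G (map (h ∘ (σ ⟨$⟩ʳ_)) ps) ≡⟨ cong G (map-∘ ps) ⟩
      G (map h qs)               ≡⟨ sym (onLists-dedup (f u) g* (map h qs)) ⟩
      G (dedup (map h qs))       ∎
      where v = Vec.tabulate h
    r = length w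
    r≤k : r ≤ k
    r≤k = ≤-trans (unique-⊆⇒length≤ w! (λ {y} _ → subst (_∈ map from (allFin k)) (strictlyInverseʳ y) (∈-map⁺ from (∈-allFin (to y)))))
            (≤-reflexive (trans (length-map from (allFin k)) (length-tabulate (λ i → i))))
      where open Inverse |A|=k
    many : 2 + r ≤ n → Agree r
    many le with m≤n⇒∃[o]m+o≡n le
    ... | d , eq = more-repeats d (permuted-↭ σ) (allFin⁺ n) conn (trans |ps|≡n (trans (sym eq) (+-comm (2 + r) d))) (s≤s z≤n)
    agree : (k + 1 ≤ n × (∀ q → suc k ≢ q * 4) × (∀ q → suc k ≢ suc (q * 4))) ⊎ k + 2 ≤ n → Agree r
    agree (inj₂ k+2≤n) = many (≤-trans (s≤s (s≤s r≤k)) (≤-trans (≤-reflexive (+-comm 2 k)) k+2≤n))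
    agree (inj₁ (k<n , k≢₁ , k≢₂)) with m≤n⇒m<n∨m≡n r≤k
    ... | inj₁ r<k = many (≤-trans (s≤s r<k) (≤-trans (≤-reflexive (+-comm 1 k)) k<n))
    ... | inj₂ r≡k with m≤n⇒m<n∨m≡n k<n
    ...   | inj₁ k+1<n = many (≤-trans (s≤s (≤-trans (s≤s r≤k) (≤-reflexive (+-comm 1 k)))) k+1<n)
    ...   | inj₂ k+1≡n = exact |ps|≡1+k (agree-or-exceptional (permuted-↭ σ) (allFin⁺ n) conn (trans |ps|≡1+k (cong suc (sym r≡k))) (s≤s z≤n))
      where
      |ps|≡1+k : length ps ≡ suc k
      |ps|≡1+k = trans |ps|≡n (trans (sym k+1≡n) (+-comm k 1))
      exact : ∀ {ps′ qs′} → length ps′ ≡ suc k → Agree r ⊎ Order.Exceptional Fin._≟_ ps′ qs′ → Agree r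
      exact _ (inj₁ agree) = agree
      exact len (inj₂ (Order.pairs q _ eq))       = ⊥-elim (k≢₁ q (trans (sym len) eq))
      exact len (inj₂ (Order.one+pairs q _ _ eq)) = ⊥-elim (k≢₂ q (trans (sym len) (cong suc eq)))

-- Inversion parity and disjoint adjacent exchanges

module Parity {k : ℕ} where

  before-odd : Fin k → List (Fin k) → Bool
  before-odd x []      = false
  before-odd x (y ∷ w) = does (y Fin.<? x) xor before-odd x w

  inversion-parity : List (Fin k) → Bool
  inversion-parity []      = false
  inversion-parity (x ∷ w) = before-odd x w xor inversion-parity w

  data Swapped : Bool → List (Fin k) → List (Fin k) → Set where
    []   : Swapped false [] []
    keep : ∀ {b v w} x → Swapped b v w → Swapped b (x ∷ v) (x ∷ w)
    swap : ∀ {b v w x y} → x ≢ y → Swapped b v w → Swapped (not b) (x ∷ y ∷ v) (y ∷ x ∷ w)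

  Swapped-length : ∀ {b v w} → Swapped b v w → length v ≡ length w
  Swapped-length []         = refl
  Swapped-length (keep x s) = cong suc (Swapped-length s)
  Swapped-length (swap _ s) = cong (2 +_) (Swapped-length s)

  Swapped-refl : ∀ w → Swapped false w w
  Swapped-refl []      = []
  Swapped-refl (x ∷ w) = keep x (Swapped-refl w)

  private
    xor-exchange : ∀ a b c → a xor (b xor c) ≡ b xor (a xor c)
    xor-exchange false b     c = refl
    xor-exchange true  false c = refl
    xor-exchange true  true  c = refl

  before-odd-swapped : ∀ {b v w} z → Swapped b v w → before-odd z v ≡ before-odd z w
  before-odd-swapped z []                 = refl
  before-odd-swapped z (keep x s)         = cong (does (x Fin.<? z) xor_) (before-odd-swapped z s)
  before-odd-swapped z (swap {x = x} {y} _ s) = trans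
    (cong (λ b → does (x Fin.<? z) xor (does (y Fin.<? z) xor b)) (before-odd-swapped z s))
    (xor-exchange (does (x Fin.<? z)) (does (y Fin.<? z)) _)

  private
    exchange : ∀ a b p q r → (not a xor q) xor (p xor (b xor r)) ≡ not b xor ((a xor p) xor (q xor r))
    exchange = solve 5 (λ a b p q r → ((con true :+ a) :+ q) :+ (p :+ (b :+ r)) :=
                                      (con true :+ b) :+ ((a :+ p) :+ (q :+ r))) refl
      where open xor-∧-Solver

    <?-flip : ∀ {x y : Fin k} → x ≢ y → does (x Fin.<? y) ≡ not (does (y Fin.<? x))
    <?-flip {x} {y} x≢y with <-cmp x y
    ... | tri< x<y _ y≮x = trans (dec-true (x Fin.<? y) x<y) (cong not (sym (dec-false (y Fin.<? x) y≮x)))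
    ... | tri≈ _ x≡y _   = ⊥-elim (x≢y x≡y)
    ... | tri> x≮y _ y<x = trans (dec-false (x Fin.<? y) x≮y) (cong not (sym (dec-true (y Fin.<? x) y<x)))

  -- By `before-odd-swapped`, the exchanges further right do not affect the comparisons with an
  -- earlier letter. So each exchange flips only the comparison between its own two letters.
  inversion-parity-swapped : ∀ {b v w} → Swapped b v w → inversion-parity w ≡ b xor inversion-parity v
  inversion-parity-swapped []         = refl
  inversion-parity-swapped {b} (keep {v = v} {w} x s) = trans
    (cong₂ _xor_ (sym (before-odd-swapped x s)) (inversion-parity-swapped s))
    (xor-exchange (before-odd x v) b (inversion-parity v))
  inversion-parity-swapped (swap {b} {v} {w} {x} {y} x≢y s)
    rewrite sym (before-odd-swapped x s) | sym (before-odd-swapped y s) | inversion-parity-swapped s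
    = trans (cong (λ c → (c xor before-odd y v) xor (before-odd x v xor (b xor inversion-parity v))) (<?-flip x≢y))
        (exchange (does (y Fin.<? x)) b (before-odd x v) (before-odd y v) (inversion-parity v))

-- First occurrences relative to the letters already seen

module Fresh {A : Set} (_≟_ : DecidableEquality A) where

  -- Abstract, so that the test on x ∷ S stays visible as such to with-abstraction.
  abstract
    infix 4 _∈?_
    _∈?_ : (x : A) (S : List A) → Dec (x ∈ S)
    x ∈? S = DecMembership._∈?_ _≟_ x S
  open Dedup _≟_ using (dedup)

  -- `deduplicate` filters the whole tail behind each letter. Carrying the letters seen so far
  -- instead lets a word be treated pair by pair from the left.
  fresh : List A → List A → List A
  fresh seen []      = []
  fresh seen (x ∷ w) = if does (x ∈? seen) then fresh seen w else x ∷ fresh (x ∷ seen) w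

  fresh-seen : ∀ {seen x} w → x ∈ seen → fresh seen (x ∷ w) ≡ fresh seen w
  fresh-seen {seen} {x} w x∈ rewrite dec-true (x ∈? seen) x∈ = refl

  fresh-new : ∀ {seen x} w → x ∉ seen → fresh seen (x ∷ w) ≡ x ∷ fresh (x ∷ seen) w
  fresh-new {seen} {x} w x∉ rewrite dec-false (x ∈? seen) x∉ = refl

  fresh-new-new : ∀ {seen x y} w → x ∉ seen → y ∉ x ∷ seen →
                  fresh seen (x ∷ y ∷ w) ≡ x ∷ y ∷ fresh (y ∷ x ∷ seen) w
  fresh-new-new w x∉ y∉ = trans (fresh-new (_ ∷ w) x∉) (cong (_ ∷_) (fresh-new w y∉))

  fresh-new-seen : ∀ {seen x y} w → x ∉ seen → y ∈ x ∷ seen →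
                   fresh seen (x ∷ y ∷ w) ≡ x ∷ fresh (x ∷ seen) w
  fresh-new-seen w x∉ y∈ = trans (fresh-new (_ ∷ w) x∉) (cong (_ ∷_) (fresh-seen w y∈))

  fresh-seen-new : ∀ {seen x y} w → x ∈ seen → y ∉ seen →
                   fresh seen (x ∷ y ∷ w) ≡ y ∷ fresh (y ∷ seen) w
  fresh-seen-new w x∈ y∉ = trans (fresh-seen (_ ∷ w) x∈) (fresh-new w y∉)

  fresh-length : ∀ seen w → length (fresh seen w) ≤ length w
  fresh-length seen []      = z≤n
  fresh-length seen (x ∷ w) with does (x ∈? seen)
  ... | true  = m≤n⇒m≤1+n (fresh-length seen w)
  ... | false = s≤s (fresh-length (x ∷ seen) w)

  fresh-≡ : ∀ seen w → fresh seen w ≡ filter (λ x → ¬? (x ∈? seen)) (dedup w)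
  fresh-≡ seen []      = refl
  fresh-≡ seen (x ∷ w) with x ∈? seen
  ... | yes x∈ = trans (fresh-≡ seen w) (sym (seen-twice (dedup w)))
    where
    seen-twice : ∀ v → filter (λ y → ¬? (y ∈? seen)) (filter (λ y → ¬? (x ≟ y)) v) ≡ filter (λ y → ¬? (y ∈? seen)) v
    seen-twice []      = refl
    seen-twice (y ∷ v) with x ≟ y
    ... | yes refl = trans (seen-twice v) (sym (filter-reject (λ y → ¬? (y ∈? seen)) (λ ∉ → ∉ x∈)))
    ... | no _ with does (y ∈? seen)
    ...   | true  = seen-twice v
    ...   | false = cong (y ∷_) (seen-twice v)
  ... | no x∉ = cong (x ∷_) (trans (fresh-≡ (x ∷ seen) w) (sym (once (dedup w))))
    where
    once : ∀ v → filter (λ y → ¬? (y ∈? seen)) (filter (λ y → ¬? (x ≟ y)) v) ≡ filter (λ y → ¬? (y ∈? (x ∷ seen))) v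
    once []      = refl
    once (y ∷ v) with x ≟ y
    ... | yes refl = trans (once v) (sym (filter-reject (λ y → ¬? (y ∈? (x ∷ seen))) (λ ∉ → ∉ (here refl))))
    ... | no x≢y = cases (y ∈? seen)
      where
      cases : Dec (y ∈ seen) → filter (λ y → ¬? (y ∈? seen)) (y ∷ filter (λ y → ¬? (x ≟ y)) v) ≡
                               filter (λ y → ¬? (y ∈? (x ∷ seen))) (y ∷ v)
      cases (yes y∈) = trans (filter-reject (λ y → ¬? (y ∈? seen)) (λ ∉ → ∉ y∈))
        (trans (once v) (sym (filter-reject (λ y → ¬? (y ∈? (x ∷ seen))) (λ ∉ → ∉ (there y∈)))))
      cases (no y∉) = trans (filter-accept (λ y → ¬? (y ∈? seen)) y∉)
        (trans (cong (y ∷_) (once v)) (sym (filter-accept (λ y → ¬? (y ∈? (x ∷ seen)))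
          λ { (here eq) → x≢y (sym eq) ; (there y∈) → y∉ y∈ })))

  dedup-fresh : ∀ w → dedup w ≡ fresh [] w
  dedup-fresh w = trans (sym (filter-all (λ x → ¬? (x ∈? [])) (All.tabulate λ _ ()))) (sym (fresh-≡ [] w))

  infix 4 _≋_

  -- After an exchange, the letters seen are accumulated in a different order but form the same set.
  _≋_ : List A → List A → Set
  S ≋ S′ = ∀ {x} → (x ∈ S → x ∈ S′) × (x ∈ S′ → x ∈ S)

  ≋-∷ : ∀ {S S′} x → S ≋ S′ → x ∷ S ≋ x ∷ S′
  ≋-∷ x e = (λ { (here eq) → here eq ; (there z∈) → there (proj₁ e z∈) }) ,
            (λ { (here eq) → here eq ; (there z∈) → there (proj₂ e z∈) })

  ≋-swap : ∀ {S S′} x y → S ≋ S′ → y ∷ x ∷ S ≋ x ∷ y ∷ S′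
  ≋-swap x y e = (λ { (here eq) → there (here eq) ; (there (here eq)) → here eq ; (there (there z∈)) → there (there (proj₁ e z∈)) }) ,
                 (λ { (here eq) → there (here eq) ; (there (here eq)) → here eq ; (there (there z∈)) → there (there (proj₂ e z∈)) })

  fresh-cong : ∀ {S S′} w → S ≋ S′ → fresh S w ≡ fresh S′ w
  fresh-cong []      e = refl
  fresh-cong {S} {S′} (x ∷ w) e with x ∈? S
  ... | yes x∈ = trans (fresh-cong w e) (sym (fresh-seen w (proj₁ e x∈)))
  ... | no x∉  = trans (cong (x ∷_) (fresh-cong w (≋-∷ x e))) (sym (fresh-new w (x∉ ∘ proj₂ e)))

-- Exchanging neighbouring positions in pairs

swap-pairs : List C → List C
swap-pairs (x ∷ y ∷ w) = y ∷ x ∷ swap-pairs w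
swap-pairs w           = w

swap-pairs-involutive : (w : List C) → swap-pairs (swap-pairs w) ≡ w
swap-pairs-involutive []          = refl
swap-pairs-involutive (x ∷ [])    = refl
swap-pairs-involutive (x ∷ y ∷ w) = cong (λ w → x ∷ y ∷ w) (swap-pairs-involutive w)

odd : ℕ → Bool
odd zero    = false
odd (suc n) = not (odd n)

module SwapPairs {k : ℕ} (_≟_ : DecidableEquality (Fin k)) where

  open Parity {k}
  open Fresh _≟_

  -- With all letters new, every pair contributes a transposition; with one repeated letter, the
  -- pair that loses it does not.
  all-new : ∀ h w {S S′} → S ≋ S′ → length w ≡ h * 2 → length (fresh S w) ≡ h * 2 →
            Swapped (odd h) (fresh S w) (fresh S′ (swap-pairs w))
  one-old : ∀ h w {S S′} → S ≋ S′ → length w ≡ h * 2 → suc (length (fresh S w)) ≡ h * 2 →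
            Swapped (not (odd h)) (fresh S w) (fresh S′ (swap-pairs w))

  private
    too-short : ∀ {S n} w → length w ≤ n → length (fresh S w) ≢ suc n
    too-short {S} w le eq = <-irrefl refl (≤-trans (≤-reflexive (sym eq)) (≤-trans (fresh-length S w) le))

  all-new zero [] e _ _ = []
  all-new (suc h) (x ∷ y ∷ w) {S} {S′} e lw eq with x ∈? S
  ... | yes _ = ⊥-elim (too-short (y ∷ w) (≤-reflexive (suc-injective lw)) eq)
  ... | no x∉ with y ∈? (x ∷ S)
  ...   | yes _ = ⊥-elim (too-short w (≤-reflexive (suc-injective (suc-injective lw))) (suc-injective eq))
  ...   | no y∉ = subst (Swapped _ _)
            (sym (fresh-new-new (swap-pairs w) (y∉ ∘ there ∘ proj₂ e)
              λ { (here x≡y) → y∉ (here (sym x≡y)) ; (there x∈) → x∉ (proj₂ e x∈) }))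
            (swap (λ x≡y → y∉ (here (sym x≡y)))
              (all-new h w (≋-swap x y e) (suc-injective (suc-injective lw)) (suc-injective (suc-injective eq))))

  one-old zero [] e _ ()
  one-old (suc h) (x ∷ y ∷ w) {S} {S′} e lw eq with x ∈? S
  one-old (suc h) (x ∷ y ∷ w) {S} {S′} e lw eq | yes x∈ with y ∈? S
  ... | yes _ = ⊥-elim (too-short w (≤-reflexive (suc-injective (suc-injective lw))) (suc-injective eq))
  ... | no y∉ = subst₂ (λ b → Swapped b _) (sym (not-involutive (odd h)))
          (sym (fresh-new-seen (swap-pairs w) (y∉ ∘ proj₂ e) (there (proj₁ e x∈))))
          (keep y (all-new h w (≋-∷ y e) (suc-injective (suc-injective lw)) (suc-injective (suc-injective eq))))
  one-old (suc h) (x ∷ y ∷ w) {S} {S′} e lw eq | no x∉ with y ∈? (x ∷ S)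
  ... | yes (here refl) = subst₂ (λ b → Swapped b _) (sym (not-involutive (odd h)))
          (sym (fresh-new-seen (swap-pairs w) (x∉ ∘ proj₂ e) (here refl)))
          (keep y (all-new h w (≋-∷ y e) (suc-injective (suc-injective lw)) (suc-injective (suc-injective eq))))
  ... | yes (there y∈) = subst₂ (λ b → Swapped b _) (sym (not-involutive (odd h)))
          (sym (fresh-seen-new (swap-pairs w) (proj₁ e y∈) (x∉ ∘ proj₂ e)))
          (keep x (all-new h w (≋-∷ x e) (suc-injective (suc-injective lw)) (suc-injective (suc-injective eq))))
  ... | no y∉ = subst (Swapped _ _)
            (sym (fresh-new-new (swap-pairs w) (y∉ ∘ there ∘ proj₂ e)
              λ { (here x≡y) → y∉ (here (sym x≡y)) ; (there x∈) → x∉ (proj₂ e x∈) }))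
            (swap (λ x≡y → y∉ (here (sym x≡y)))
              (one-old h w (≋-swap x y e) (suc-injective (suc-injective lw)) (suc-injective (suc-injective eq))))

pairing : ∀ h → Permutation′ (h * 2)
pairing zero    = Permutation.id
pairing (suc h) = Permutation.swap (pairing h)

toList-pairing : ∀ h (u : Vec C (h * 2)) → toList (u · pairing h) ≡ swap-pairs (toList u)
toList-pairing zero    []          = refl
toList-pairing (suc h) (x ∷ y ∷ u) = cong (λ w → y ∷ x ∷ w) (toList-pairing h u)

swap-pairs-tail : List C → List C
swap-pairs-tail []      = []
swap-pairs-tail (x ∷ w) = x ∷ swap-pairs w

swap-heads : List C → List C
swap-heads (x ∷ y ∷ w) = y ∷ x ∷ w
swap-heads w           = w

swap-heads-involutive : (w : List C) → swap-heads (swap-heads w) ≡ w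
swap-heads-involutive []          = refl
swap-heads-involutive (x ∷ [])    = refl
swap-heads-involutive (x ∷ y ∷ w) = refl

toList-id : ∀ {n} (u : Vec C n) → toList (u · Permutation.id) ≡ toList u
toList-id u = cong toList (tabulate∘lookup u)

fromLength : ∀ {n} (w : List C) → length w ≡ n → ∃ λ (u : Vec C n) → toList u ≡ w
fromLength w refl = Vec.fromList w , toList∘fromList w

-- Counterexamples from parity

module Refutation {ℓ} {B : Set ℓ} {x y : B} (x≢y : x ≢ y) (k : ℕ) where

  _≟_ : DecidableEquality (Fin k)
  _≟_ = inj⇒≟ (↔⇒↣ (↔-id (Fin k)))

  open Dedup _≟_
  open Fresh _≟_
  open Parity {k}

  -- `op` is the action of `σ` on lists. Being an involution, it also takes words without `m`
  -- distinct letters to such words. The word `w₀` is where the two functions differ.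
  record Counterexample (n : ℕ) : Set where
    field
      σ           : Permutation′ n
      op          : List (Fin k) → List (Fin k)
      toList-σ    : ∀ u → toList (u · σ) ≡ op (toList u)
      involutive  : ∀ w → op (op w) ≡ w
      m           : ℕ
      swapped     : ∀ w → length w ≡ n → length (fresh [] w) ≡ m → Swapped true (fresh [] w) (fresh [] (op w))
      w₀          : List (Fin k)
      w₀-length   : length w₀ ≡ n
      w₀-letters  : length (dedup w₀) ≡ m

  -- f and g read off opposite parities of the words with m letters, and σ changes these parities.
  refute : ∀ {n} .{{_ : NonZero n}} → Counterexample n → ¬ Equalizing B n k
  refute {n} c equalizing = values-differ (equalizing (Fin k) (↔-id (Fin k))
      (λ u → value id (entries (ofo _≟_ u))) (λ u → value not (entries (ofo _≟_ u)))
      ((λ t → value id (entries t)) , λ _ → refl) ((λ t → value not (entries t)) , λ _ → refl)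
      (σ , λ u → trans (cong (value id) (dedup-fresh (toList u)))
        (trans (agree (toList u) (op (toList u)) (length-vec u) (trans (cong length (sym (toList-σ u))) (length-vec (u · σ))) refl)
          (cong (value not) (sym (trans (cong dedup (toList-σ u)) (dedup-fresh (op (toList u)))))))) u₀)
    where
    open Counterexample c
    length-vec : (u : Vec (Fin k) n) → length (toList u) ≡ n
    length-vec = length-toList
    u₀ : Vec (Fin k) n
    u₀ = proj₁ (fromLength w₀ w₀-length)
    -- Words with another number of letters get the value `x` for both choices of `φ`, so `σ` has
    -- nothing to reverse there.
    value : (Bool → Bool) → List (Fin k) → B
    value φ w = if does (length w ℕ.≟ m) then (if φ (inversion-parity w) then x else y) else x
    value-yes : ∀ φ w → length w ≡ m → value φ w ≡ (if φ (inversion-parity w) then x else y)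
    value-yes φ w eq = cong (λ b → if b then (if φ (inversion-parity w) then x else y) else x) (dec-true (length w ℕ.≟ m) eq)
    value-no : ∀ φ w → length w ≢ m → value φ w ≡ x
    value-no φ w neq = cong (λ b → if b then (if φ (inversion-parity w) then x else y) else x) (dec-false (length w ℕ.≟ m) neq)
    agree : ∀ v w → length v ≡ n → length w ≡ n → op v ≡ w → value id (fresh [] v) ≡ value not (fresh [] w)
    agree v w lv lw refl = cases (length (fresh [] v) ℕ.≟ m)
      where
      cases : Dec (length (fresh [] v) ≡ m) → value id (fresh [] v) ≡ value not (fresh [] (op v))
      cases (yes eq) = trans (value-yes id (fresh [] v) eq) (trans
          (cong (λ b → if b then x else y) (sym (trans (cong not (inversion-parity-swapped s)) (not-involutive (inversion-parity (fresh [] v))))))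
          (sym (value-yes not (fresh [] (op v)) (trans (sym (Swapped-length s)) eq))))
        where s = swapped v lv eq
      cases (no neq) = trans (value-no id (fresh [] v) neq) (sym (value-no not (fresh [] (op v)) λ eq → neq (trans
          (cong (length ∘ fresh []) (sym (involutive v)))
          (trans (sym (Swapped-length (swapped (op v) lw eq))) eq))))
    w₀-value : ∀ φ → value φ (entries (ofo _≟_ u₀)) ≡ (if φ (inversion-parity (dedup w₀)) then x else y)
    w₀-value φ = trans (cong (value φ ∘ dedup) (proj₂ (fromLength w₀ w₀-length))) (value-yes φ (dedup w₀) w₀-letters)
    values-differ : value id (entries (ofo _≟_ u₀)) ≢ value not (entries (ofo _≟_ u₀))
    values-differ eq = split (inversion-parity (dedup w₀)) (trans (sym (w₀-value id)) (trans eq (w₀-value not)))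
      where
      split : ∀ b → (if b then x else y) ≢ (if not b then x else y)
      split true  eq = x≢y eq
      split false eq = x≢y (sym eq)

  private
    ≋-refl : ∀ {S} → S ≋ S
    ≋-refl = id , id

    letter-repeated : ∀ k (_≟_ : DecidableEquality (Fin k)) → 1 ≤ k →
                      ∃ λ w → length w ≡ suc k × length (Dedup.dedup _≟_ w) ≡ k
    letter-repeated (suc k) _≟_ _ = zero ∷ allFin (suc k) , cong suc |allFin| ,
      trans (cong length (trans (Dedup.dedup-repeat _≟_ {[ zero ]} {zero} {tabulate suc} (here refl))
                                (Dedup.dedup-unique _≟_ (allFin⁺ (suc k))))) |allFin|
      where
      |allFin| : length (allFin (suc k)) ≡ suc k
      |allFin| = length-tabulate id

  -- A word with `k` letters has one repetition, which spoils one of the `h` pairs; an odd number of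
  -- exchanges remains.
  even-counterexample : ∀ h → odd h ≡ false → 1 ≤ k → suc k ≡ h * 2 → Counterexample (h * 2)
  even-counterexample h even 1≤k eq with letter-repeated k _≟_ 1≤k
  ... | w , lw , letters = record
    { σ = pairing h ; op = swap-pairs ; toList-σ = toList-pairing h ; involutive = swap-pairs-involutive
    ; m = k ; w₀ = w ; w₀-length = trans lw eq ; w₀-letters = letters
    ; swapped = λ w lw lf → subst (λ b → Swapped (not b) (fresh [] w) (fresh [] (swap-pairs w))) even
        (SwapPairs.one-old _≟_ h w ≋-refl lw (trans (cong suc lf) eq)) }

  -- The first position is fixed. Its letter may be the repeated one, so the pairs behind it are
  -- read with that letter already seen.
  odd-counterexample : ∀ h → odd h ≡ false → 1 ≤ k → k ≡ h * 2 → Counterexample (suc (h * 2))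
  odd-counterexample h even 1≤k eq with letter-repeated k _≟_ 1≤k
  ... | w , lw , letters = record
    { σ = Permutation.lift₀ (pairing h) ; op = swap-pairs-tail
    ; toList-σ = λ { (x ∷ u) → cong (x ∷_) (toList-pairing h u) }
    ; involutive = λ { [] → refl ; (x ∷ w) → cong (x ∷_) (swap-pairs-involutive w) }
    ; m = k ; w₀ = w ; w₀-length = trans lw (cong suc eq) ; w₀-letters = letters
    ; swapped = λ { (z ∷ w) lw lf → subst (λ b → Swapped (not b) (fresh [] (z ∷ w)) (fresh [] (z ∷ swap-pairs w))) even
        (subst₂ (Swapped (not (odd h))) (sym (fresh-new w λ ())) (sym (fresh-new (swap-pairs w) λ ()))
          (keep z (SwapPairs.one-old _≟_ h w ≋-refl (suc-injective lw)
            (trans (cong length (sym (fresh-new w λ ()))) (trans lf eq))))) } }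

  short-counterexample : ∀ {n} → 2 + n ≤ k → Counterexample (2 + n)
  short-counterexample {n} n≤k = record
    { σ = Permutation.swap Permutation.id ; op = swap-heads
    ; toList-σ = λ { (x ∷ y ∷ u) → cong (λ w → y ∷ x ∷ w) (toList-id u) }
    ; involutive = swap-heads-involutive
    ; m = 2 + n ; w₀ = w ; w₀-length = lw
    ; w₀-letters = trans (cong length (dedup-unique w!)) lw
    ; swapped = λ { (x ∷ y ∷ w) lw lf → exchange x y w (suc-injective (suc-injective lw)) lf (y ∈? [ x ]) } }
    where
    w = map (λ i → inject≤ i n≤k) (allFin (2 + n))
    lw : length w ≡ 2 + n
    lw = trans (length-map _ (allFin (2 + n))) (length-tabulate {n = 2 + n} id)
    w! : Unique w
    w! = UniqueProperties.map⁺ (inject≤-injective n≤k n≤k _ _) (allFin⁺ (2 + n))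
    exchange : ∀ x y w → length w ≡ n → length (fresh [] (x ∷ y ∷ w)) ≡ 2 + n → Dec (y ∈ [ x ]) →
               Swapped true (fresh [] (x ∷ y ∷ w)) (fresh [] (y ∷ x ∷ w))
    exchange x y w lw lf (yes y∈) = ⊥-elim (<-irrefl refl (≤-trans
      (≤-reflexive (sym (suc-injective (trans (cong length (sym (fresh-new-seen w (λ ()) y∈))) lf))))
      (≤-trans (fresh-length [ x ] w) (≤-reflexive lw))))
    exchange x y w lw lf (no y∉) = subst₂ (Swapped true)
      (sym (fresh-new-new w (λ ()) y∉)) (sym (fresh-new-new w (λ ()) λ { (here x≡y) → y∉ (here (sym x≡y)) }))
      (subst (λ v → Swapped true (x ∷ y ∷ fresh (y ∷ x ∷ []) w) (y ∷ x ∷ v)) (fresh-cong w (≋-swap x y ≋-refl))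
        (swap (λ x≡y → y∉ (here (sym x≡y))) (Swapped-refl _)))

-- Residues modulo 4 and the equivalence

odd-double : ∀ q → odd (q * 2) ≡ false
odd-double zero    = refl
odd-double (suc q) = trans (not-involutive (odd (q * 2))) (odd-double q)

k%4≡3 : ∀ {k q} → suc k ≡ q * 4 → k % 4 ≡ 3
k%4≡3 {q = suc q} refl = [m+kn]%n≡m%n 3 q 4

k%4≡0 : ∀ {k q} → suc k ≡ suc (q * 4) → k % 4 ≡ 0
k%4≡0 {q = q} refl = m*n%n≡0 q 4

counterexample-or-bound : ∀ {ℓ} {B : Set ℓ} {x y : B} (x≢y : x ≢ y) n k → n ≥ 2 → k ≥ 2 →
  Refutation.Counterexample x≢y k n ⊎
    (((k % 4 ≡ 1 ⊎ k % 4 ≡ 2) × n ≥ k + 1) ⊎ ((k % 4 ≡ 0 ⊎ k % 4 ≡ 3) × n ≥ k + 2))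
counterexample-or-bound x≢y n k n≥2 k≥2 with k + 1 ℕ.≤? n
counterexample-or-bound x≢y (suc (suc n)) k n≥2 k≥2 | no k≮n =
  inj₁ (Refutation.short-counterexample x≢y k (≤-pred (≤-trans (≰⇒> k≮n) (≤-reflexive (+-comm k 1)))))
counterexample-or-bound x≢y (suc zero) k (s≤s ()) k≥2 | no k≮n
counterexample-or-bound x≢y n k n≥2 k≥2 | yes k<n = residue (k % 4) refl (m%n<n k 4) (m≤n⇒m<n∨m≡n k<n)
  where
  open Refutation x≢y k
  q = k / 4
  1≤k = ≤-trans (s≤s z≤n) k≥2
  k≡ : ∀ {r} → r ≡ k % 4 → k ≡ r + q * 4
  k≡ refl = m≡m%n+[m/n]*n k 4
  2+ : suc (k + 1) ≤ n → k + 2 ≤ n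
  2+ = ≤-trans (≤-reflexive (+-suc k 1))
  residue : ∀ r → r ≡ k % 4 → r < 4 → (k + 1 < n) ⊎ (k + 1 ≡ n) → Counterexample n ⊎
    (((k % 4 ≡ 1 ⊎ k % 4 ≡ 2) × n ≥ k + 1) ⊎ ((k % 4 ≡ 0 ⊎ k % 4 ≡ 3) × n ≥ k + 2))
  residue 0 eq _ (inj₁ k+1<n) = inj₂ (inj₂ (inj₁ (sym eq) , 2+ k+1<n))
  -- The `4q + 1` positions are one fixed position and `q * 2` pairs.
  residue 0 eq _ (inj₂ refl)  = inj₁ (subst Counterexample (trans (cong suc (sym k≡h)) (+-comm 1 k))
                                  (odd-counterexample (q * 2) (odd-double q) 1≤k k≡h))
    where k≡h = trans (k≡ eq) (sym (*-assoc q 2 2))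
  residue 1 eq _ _ = inj₂ (inj₁ (inj₁ (sym eq) , k<n))
  residue 2 eq _ _ = inj₂ (inj₁ (inj₂ (sym eq) , k<n))
  residue 3 eq _ (inj₁ k+1<n) = inj₂ (inj₂ (inj₂ (sym eq) , 2+ k+1<n))
  -- Here `k + 1 = 4(q + 1)`, so the positions form `suc q * 2` pairs.
  residue 3 eq _ (inj₂ refl)  = inj₁ (subst Counterexample (trans (sym k≡h) (+-comm 1 k))
                                  (even-counterexample (suc q * 2) (odd-double (suc q)) 1≤k k≡h))
    where k≡h = trans (cong suc (k≡ eq)) (sym (*-assoc (suc q) 2 2))
  residue (suc (suc (suc (suc _)))) _ (s≤s (s≤s (s≤s (s≤s ()))))

theorem7p1 : ∀ {b} (B : Set b) → (∃₂ λ (x y : B) → x ≢ y) →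
    (n k : ℕ) .{{_ : NonZero n}} → n ≥ 2 → k ≥ 2 →
    Equalizing B n k ⇔
    (((k % 4 ≡ 1 ⊎ k % 4 ≡ 2) × n ≥ k + 1) ⊎
    ((k % 4 ≡ 0 ⊎ k % 4 ≡ 3) × n ≥ k + 2))
theorem7p1 B (x , y , x≢y) n k n≥2 k≥2 = mk⇔ necessary sufficient
  where
  Bound : Set
  Bound = ((k % 4 ≡ 1 ⊎ k % 4 ≡ 2) × n ≥ k + 1) ⊎ ((k % 4 ≡ 0 ⊎ k % 4 ≡ 3) × n ≥ k + 2)
  necessary : Equalizing B n k → Bound
  necessary eqz with counterexample-or-bound x≢y n k n≥2 k≥2
  ... | inj₁ c     = ⊥-elim (Refutation.refute x≢y k c eqz)
  ... | inj₂ bound = bound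
  sufficient : Bound → Equalizing B n k
  sufficient bound A |A|=k = equalizing (inj⇒≟ (↔⇒↣ |A|=k)) |A|=k (cases bound)
    where
    not-0-or-3 : ∀ {r} → r ≡ 1 ⊎ r ≡ 2 → r ≢ 0 × r ≢ 3
    not-0-or-3 (inj₁ refl) = (λ ()) , λ ()
    not-0-or-3 (inj₂ refl) = (λ ()) , λ ()
    cases : Bound → (k + 1 ≤ n × (∀ q → suc k ≢ q * 4) × (∀ q → suc k ≢ suc (q * 4))) ⊎ k + 2 ≤ n
    cases (inj₁ (k% , k<n)) = inj₁ (k<n , (λ q eq → proj₂ (not-0-or-3 k%) (k%4≡3 {q = q} eq)) ,
                                          (λ q eq → proj₁ (not-0-or-3 k%) (k%4≡0 {q = q} eq)))
    cases (inj₂ (_ , k+1<n)) = inj₂ k+1<n
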